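{- Let $\lambda\ge 2$, and let $\mathcal{D}$ be the design obtained from a projective plane with line size $k$ and $v=k^2-k+1$ points by repeating each line $\lambda$ times. Let $\Gamma$ be the graph whose vertices are the $v$ points and the $\lambda v$ blocks of $\mathcal{D}$, where any two distinct points are adjacent, a point and a block are adjacent if and only if they are incident, and two distinct blocks are adjacent if and only if they are copies of the same line (so the blocks induce a disjoint union of cliques of size $\lambda$). Then $\Gamma$ has exactly three distinct $\mathcal{L}$-eigenvalues, the non-trivial (non-zero) ones being $\frac{v}{k^2+k(\lambda-1)}$ and $1+\frac{1}{k+\lambda-1}$.
   Context: All graphs are finite, simple and undirected. $d_u$ denotes the valency (degree) of vertex $u$. The normalized Laplacian of a graph is the matrix $\mathcal{L}=[\ell_{uv}]$ indexed by the vertices with $\ell_{uu}=1$ if $d_u\neq 0$, $\ell_{uv}=-1/\sqrt{d_ud_v}$ if $u$ and $v$ are adjacent, and $\ell_{uv}=0$ otherwise. Its eigenvalues are called the $\mathcal{L}$-eigenvalues of the graph. A projective plane with line size $k$ means here a symmetric $2$-$(k^2-k+1,k,1)$ design with $k\ge2$: there are $v=k^2-k+1$ points and $v$ lines, every line has $k$ points, every point is on $k$ lines, and any two distinct points are on exactly one common line. -}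

module Defs where

open import Algebra.Bundles using (CommutativeRing)
open import Data.Bool.Base using (if_then_else_)
open import Data.Empty using (⊥-elim)
open import Data.Fin.Base using (Fin)
open import Data.Fin.Properties using (+↔⊎; *↔×) renaming (_≟_ to _≟ᶠ_)
import Data.Integer.Base as ℤ
import Data.Integer.Properties as ℤₚ
open import Data.List.Base using (List)
open import Data.Nat.Base as ℕ using (ℕ; zero; suc)
import Data.Nat.Coprimality as Coprimality
import Data.Nat.Properties as ℕₚ
open import Data.Product using (∃!; ∃-syntax; Σ-syntax; _×_; _,_; proj₁; proj₂)
open import Data.Product.Properties using (≡-dec)
open import Data.Rational.Base
open import Data.Rational.Properties
open import Data.Rational.Solver using (module +-*-Solver)
open import Data.Sum.Base using (_⊎_; inj₁; inj₂)
open import Data.Sum.Function.Propositional using (_⊎-↔_)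
open import Data.Vec.Base using (count; allFin)
open import Function.Base using (_∘_)
open import Function.Bundles using (_↔_; _⇔_; Inverse)
open import Function.Construct.Composition using (_↔-∘_)
open import Function.Construct.Identity using (↔-id)
open import Function.Properties.Inverse using (↔-sym; ↔⇒↣)
open import Level using (0ℓ)
open import Relation.Binary.Core using (Rel; REL)
open import Relation.Binary.Definitions using (Decidable; DecidableEquality; Symmetric; Irreflexive)
open import Relation.Binary.PropositionalEquality
open import Relation.Nullary using (¬_; Dec; yes; no; does; ¬?; contradiction)
open import Relation.Nullary.Decidable using (_×-dec_; from-yes; via-injection)
import Data.List.Membership.Setoid as SetoidMembership
import Data.List.Relation.Unary.Unique.Setoid as SetoidUnique
import Algebra.Properties.Monoid.Sum as MonoidSum

------------------------------------------------------------------------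
-- Null families of rationals.  _≼_ says how far out an index is; it is
-- used with I = ℕ (for limits) and I = ℕ × ℕ (for the Cauchy property).

0<½ : 0ℚ < ½
0<½ = positive⁻¹ ½

0<* : ∀ {p q} → 0ℚ < p → 0ℚ < q → 0ℚ < p * q
0<* {p} {q} 0<p 0<q = positive⁻¹ (p * q)
  where instance
    _ = positive 0<p
    _ = positive 0<q
    _ = pos*pos⇒pos p q

½+½ : ∀ ε → ½ * ε + ½ * ε ≡ ε
½+½ ε = trans (sym (*-distribʳ-+ ε ½ ½)) (*-identityˡ ε)

module NullFamily {I : Set} (_≼_ : ℕ → I → Set)
  (antitone : ∀ {M N i} → M ℕ.≤ N → N ≼ i → M ≼ i) where

  Null : (I → ℚ) → Set
  Null f = ∀ ε → 0ℚ < ε → ∃[ N ] ∀ i → N ≼ i → ∣ f i ∣ < ε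

  Bounded : (I → ℚ) → Set
  Bounded f = ∃[ B ] (0ℚ < B) × ∃[ N ] ∀ i → N ≼ i → ∣ f i ∣ ≤ B

  null-0 : ∀ {f} → (∀ i → f i ≡ 0ℚ) → Null f
  null-0 f≡0 ε 0<ε = 0 , λ i _ → subst (λ p → ∣ p ∣ < ε) (sym (f≡0 i)) 0<ε

  null-resp : ∀ {f g} → (∀ i → f i ≡ g i) → Null f → Null g
  null-resp f≡g nf ε 0<ε =
    let N , h = nf ε 0<ε in N , λ i le → subst (λ p → ∣ p ∣ < ε) (f≡g i) (h i le)

  null-neg : ∀ {f} → Null f → Null (λ i → - f i)
  null-neg {f} nf ε 0<ε =
    let N , h = nf ε 0<ε in
    N , λ i le → subst (_< ε) (sym (∣-p∣≡∣p∣ (f i))) (h i le)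

  null-+ : ∀ {f g} → Null f → Null g → Null (λ i → f i + g i)
  null-+ {f} {g} nf ng ε 0<ε =
    let M , h = nf (½ * ε) (0<* 0<½ 0<ε)
        N , k = ng (½ * ε) (0<* 0<½ 0<ε)
    in M ℕ.⊔ N , λ i le →
      ≤-<-trans (∣p+q∣≤∣p∣+∣q∣ (f i) (g i))
        (subst (∣ f i ∣ + ∣ g i ∣ <_) (½+½ ε)
          (+-mono-< (h i (antitone (ℕₚ.m≤m⊔n M N) le))
                    (k i (antitone (ℕₚ.m≤n⊔m M N) le))))

  null-* : ∀ {f g} → Null f → Bounded g → Null (λ i → f i * g i)
  null-* {f} {g} nf (B , 0<B , N , k) ε 0<ε =
    let M , h = nf δ (0<* 0<ε (positive⁻¹ (1/ B)))
    in M ℕ.⊔ N , λ i le →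
      subst₂ _<_ (sym (∣p*q∣≡∣p∣*∣q∣ (f i) (g i))) δB≡ε
        (≤-<-trans
          (*-monoˡ-≤-nonNeg ∣ f i ∣ {{∣-∣-nonNeg (f i)}}
             (k i (antitone (ℕₚ.m≤n⊔m M N) le)))
          (*-monoˡ-<-pos B (h i (antitone (ℕₚ.m≤m⊔n M N) le))))
    where
    instance
      B-pos = positive 0<B
      B-nonZero = pos⇒nonZero B
      1/B-pos = 1/pos⇒pos B
    δ = ε * 1/ B
    δB≡ε : δ * B ≡ ε
    δB≡ε = trans (*-assoc ε (1/ B) B)
             (trans (cong (ε *_) (*-inverseˡ B)) (*-identityʳ ε))

module Null₁ = NullFamily {ℕ} ℕ._≤_ ℕₚ.≤-trans

module Null₂ = NullFamily {ℕ × ℕ} (λ N (m , n) → N ℕ.≤ m × N ℕ.≤ n)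
  (λ le (a , b) → ℕₚ.≤-trans le a , ℕₚ.≤-trans le b)

------------------------------------------------------------------------
-- The real numbers, as Cauchy sequences of rationals

record ℝ : Set where
  constructor mkℝ
  field
    seq    : ℕ → ℚ
    cauchy : Null₂.Null (λ (m , n) → seq m - seq n)

open ℝ public

infix 4 _≈_ _≉_

_≈_ : Rel ℝ 0ℓ
x ≈ y = Null₁.Null (λ n → seq x n - seq y n)

_≉_ : Rel ℝ 0ℓ
x ≉ y = ¬ x ≈ y

infixl 6 _+ᴿ_
infixl 7 _*ᴿ_
infix  8 -ᴿ_

fromℚ : ℚ → ℝ
fromℚ q = mkℝ (λ _ → q) (Null₂.null-0 (λ _ → +-inverseʳ q))

private
  open +-*-Solver

  +-rearrange : ∀ a b c d → (a - b) + (c - d) ≡ (a + c) - (b + d)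
  +-rearrange = solve 4 (λ a b c d → (a :- b) :+ (c :- d) := (a :+ c) :- (b :+ d)) refl

  *-rearrange : ∀ a b c d → (a - b) * c + (c - d) * b ≡ a * c - b * d
  *-rearrange = solve 4 (λ a b c d → (a :- b) :* c :+ (c :- d) :* b := a :* c :- b :* d) refl

  neg-rearrange : ∀ a b → - (a - b) ≡ (- a) - (- b)
  neg-rearrange = solve 2 (λ a b → :- (a :- b) := (:- a) :- (:- b)) refl

  swap-rearrange : ∀ a b → - (a - b) ≡ b - a
  swap-rearrange = solve 2 (λ a b → :- (a :- b) := b :- a) refl

  trans-rearrange : ∀ a b c → (a - b) + (b - c) ≡ a - c
  trans-rearrange = solve 3 (λ a b c → (a :- b) :+ (b :- c) := a :- c) refl

  split : ∀ a b → a + (b - a) ≡ b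
  split = solve 2 (λ a b → a :+ (b :- a) := b) refl

seq-bounded : ∀ x → Null₁.Bounded (seq x)
seq-bounded x =
  let N , h = cauchy x 1ℚ (positive⁻¹ 1ℚ)
      a = seq x N
  in ∣ a ∣ + 1ℚ
   , +-mono-≤-< (0≤∣p∣ a) (positive⁻¹ 1ℚ)
   , N , λ n N≤n →
       ≤-trans (≤-reflexive (cong ∣_∣ (sym (split a (seq x n)))))
         (≤-trans (∣p+q∣≤∣p∣+∣q∣ a (seq x n - a))
           (+-monoʳ-≤ ∣ a ∣ (<⇒≤ (h (n , N) (N≤n , ℕₚ.≤-refl)))))

bounded-fst : ∀ x → Null₂.Bounded (λ (m , _) → seq x m)
bounded-fst x = let B , 0<B , N , h = seq-bounded x
                in B , 0<B , N , λ (m , _) (le , _) → h m le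

bounded-snd : ∀ x → Null₂.Bounded (λ (_ , n) → seq x n)
bounded-snd x = let B , 0<B , N , h = seq-bounded x
                in B , 0<B , N , λ (_ , n) (_ , le) → h n le

_+ᴿ_ : ℝ → ℝ → ℝ
x +ᴿ y = mkℝ (λ n → seq x n + seq y n)
  (Null₂.null-resp
    (λ (m , n) → +-rearrange (seq x m) (seq x n) (seq y m) (seq y n))
    (Null₂.null-+ (cauchy x) (cauchy y)))

_*ᴿ_ : ℝ → ℝ → ℝ
x *ᴿ y = mkℝ (λ n → seq x n * seq y n)
  (Null₂.null-resp
    (λ (m , n) → *-rearrange (seq x m) (seq x n) (seq y m) (seq y n))
    (Null₂.null-+ (Null₂.null-* (cauchy x) (bounded-fst y))
                  (Null₂.null-* (cauchy y) (bounded-snd x))))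

-ᴿ_ : ℝ → ℝ
-ᴿ x = mkℝ (λ n → - seq x n)
  (Null₂.null-resp (λ (m , n) → neg-rearrange (seq x m) (seq x n))
    (Null₂.null-neg (cauchy x)))

≈-pointwise : ∀ {x y} → (∀ n → seq x n ≡ seq y n) → x ≈ y
≈-pointwise {x} {y} eq = Null₁.null-0 λ n →
  trans (cong (_- seq y n) (eq n)) (+-inverseʳ (seq y n))

≈-refl : ∀ {x} → x ≈ x
≈-refl {x} = ≈-pointwise {x} {x} (λ _ → refl)

≈-sym : ∀ {x y} → x ≈ y → y ≈ x
≈-sym {x} {y} p = Null₁.null-resp (λ n → swap-rearrange (seq x n) (seq y n))
  (Null₁.null-neg p)

≈-trans : ∀ {x y z} → x ≈ y → y ≈ z → x ≈ z
≈-trans {x} {y} {z} p q = Null₁.null-resp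
  (λ n → trans-rearrange (seq x n) (seq y n) (seq z n)) (Null₁.null-+ p q)

ℝ-commutativeRing : CommutativeRing 0ℓ 0ℓ
ℝ-commutativeRing = record
  { Carrier = ℝ
  ; _≈_ = _≈_
  ; _+_ = _+ᴿ_
  ; _*_ = _*ᴿ_
  ; -_ = -ᴿ_
  ; 0# = fromℚ 0ℚ
  ; 1# = fromℚ 1ℚ
  ; isCommutativeRing = record
    { isRing = record
      { +-isAbelianGroup = record
        { isGroup = record
          { isMonoid = record
            { isSemigroup = record
              { isMagma = record
                { isEquivalence = record
                  { refl = λ {x} → ≈-refl {x}
                  ; sym = λ {x} {y} → ≈-sym {x} {y}
                  ; trans = λ {x} {y} {z} → ≈-trans {x} {y} {z}
                  }
                ; ∙-cong = λ {x} {x′} {y} {y′} p q → Null₁.null-resp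
                    (λ n → +-rearrange (seq x n) (seq x′ n) (seq y n) (seq y′ n))
                    (Null₁.null-+ p q)
                }
              ; assoc = λ x y z → ≈-pointwise {(x +ᴿ y) +ᴿ z} {x +ᴿ (y +ᴿ z)}
                  λ n → +-assoc (seq x n) (seq y n) (seq z n)
              }
            ; identity =
                (λ x → ≈-pointwise {fromℚ 0ℚ +ᴿ x} {x} λ n → +-identityˡ (seq x n))
              , (λ x → ≈-pointwise {x +ᴿ fromℚ 0ℚ} {x} λ n → +-identityʳ (seq x n))
            }
          ; inverse =
              (λ x → ≈-pointwise {(-ᴿ x) +ᴿ x} {fromℚ 0ℚ} λ n → +-inverseˡ (seq x n))
            , (λ x → ≈-pointwise {x +ᴿ (-ᴿ x)} {fromℚ 0ℚ} λ n → +-inverseʳ (seq x n))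
          ; ⁻¹-cong = λ {x} {y} p → Null₁.null-resp
              (λ n → neg-rearrange (seq x n) (seq y n)) (Null₁.null-neg p)
          }
        ; comm = λ x y → ≈-pointwise {x +ᴿ y} {y +ᴿ x}
            λ n → +-comm (seq x n) (seq y n)
        }
      ; *-cong = λ {x} {x′} {y} {y′} p q → Null₁.null-resp
          (λ n → *-rearrange (seq x n) (seq x′ n) (seq y n) (seq y′ n))
          (Null₁.null-+ (Null₁.null-* p (seq-bounded y))
                        (Null₁.null-* q (seq-bounded x′)))
      ; *-assoc = λ x y z → ≈-pointwise {(x *ᴿ y) *ᴿ z} {x *ᴿ (y *ᴿ z)}
          λ n → *-assoc (seq x n) (seq y n) (seq z n)
      ; *-identity =
          (λ x → ≈-pointwise {fromℚ 1ℚ *ᴿ x} {x} λ n → *-identityˡ (seq x n))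
        , (λ x → ≈-pointwise {x *ᴿ fromℚ 1ℚ} {x} λ n → *-identityʳ (seq x n))
      ; distrib =
          (λ x y z → ≈-pointwise {x *ᴿ (y +ᴿ z)} {(x *ᴿ y) +ᴿ (x *ᴿ z)}
             λ n → *-distribˡ-+ (seq x n) (seq y n) (seq z n))
        , (λ x y z → ≈-pointwise {(y +ᴿ z) *ᴿ x} {(y *ᴿ x) +ᴿ (z *ᴿ x)}
             λ n → *-distribʳ-+ (seq x n) (seq y n) (seq z n))
      }
    ; *-comm = λ x y → ≈-pointwise {x *ᴿ y} {y *ᴿ x}
        λ n → *-comm (seq x n) (seq y n)
    }
  }

module ℝ-ring = CommutativeRing ℝ-commutativeRing
open MonoidSum ℝ-ring.+-monoid public using (sum)

------------------------------------------------------------------------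
-- Square roots of rationals, by bisection: for q ≥ 0 the invariant is
-- (lower q n)² ≤ q < (lower q n + width q n)².  For q < 0 the value is 0.

width : ℚ → ℕ → ℚ
width q zero    = q + 1ℚ
width q (suc n) = ½ * width q n

lower : ℚ → ℕ → ℚ
lower q zero    = 0ℚ
lower q (suc n) =
  let mid = lower q n + width q (suc n) in
  if does (mid * mid ≤? q) then mid else lower q n

*-nonNeg : ∀ {p q} → 0ℚ ≤ p → 0ℚ ≤ q → 0ℚ ≤ p * q
*-nonNeg {p} {q} 0≤p 0≤q = nonNegative⁻¹ (p * q)
  where instance
    _ = nonNegative 0≤p
    _ = nonNegative 0≤q
    _ = nonNeg*nonNeg⇒nonNeg p q

*-mono : ∀ {p q r s} → 0ℚ ≤ r → 0ℚ ≤ q → p ≤ q → r ≤ s → p * r ≤ q * s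
*-mono {p} {q} {r} {s} 0≤r 0≤q p≤q r≤s =
  ≤-trans (*-monoʳ-≤-nonNeg r {{nonNegative 0≤r}} p≤q)
          (*-monoˡ-≤-nonNeg q {{nonNegative 0≤q}} r≤s)

square-cancel-< : ∀ {p q} → 0ℚ ≤ q → p * p < q * q → p < q
square-cancel-< {p} {q} 0≤q lt with p <? q
... | yes p<q = p<q
... | no  p≮q = ⊥-elim (<-irrefl refl (<-≤-trans lt
                  (*-mono 0≤q (≤-trans 0≤q q≤p) q≤p q≤p)))
  where q≤p = ≮⇒≥ p≮q

ℕ→ℚ : ℕ → ℚ
ℕ→ℚ n = mkℚ (ℤ.+ n) 0 (Coprimality.sym (Coprimality.1-coprimeTo n))

ℕ→ℚ-suc : ∀ n → ℕ→ℚ (suc n) ≡ 1ℚ + ℕ→ℚ n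
ℕ→ℚ-suc n = sym (trans
  (cong (λ i → (ℤ.+ 1 ℤ.+ i) / 1) (ℤₚ.*-identityʳ (ℤ.+ n)))
  (normalize-coprime (Coprimality.sym (Coprimality.1-coprimeTo (suc n)))))

0≤ℕ→ℚ : ∀ n → 0ℚ ≤ ℕ→ℚ n
0≤ℕ→ℚ n = nonNegative⁻¹ (ℕ→ℚ n)

<-ℕ→ℚ : ∀ p → ∃[ n ] p < ℕ→ℚ n
<-ℕ→ℚ (mkℚ (ℤ.+ m) d c) = suc m , *<* (subst₂ ℤ._<_
  (sym (ℤₚ.*-identityʳ (ℤ.+ m))) (ℤₚ.pos-* (suc m) (suc d))
  (ℤ.+<+ (ℕₚ.m≤m*n (suc m) (suc d))))
<-ℕ→ℚ (mkℚ ℤ.-[1+ m ] d c) = 0 , *<* ℤ.-<+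

half^ : ℕ → ℚ
half^ zero    = 1ℚ
half^ (suc n) = ½ * half^ n

0<half^ : ∀ n → 0ℚ < half^ n
0<half^ zero    = positive⁻¹ 1ℚ
0<half^ (suc n) = 0<* 0<½ (0<half^ n)

half^≤1 : ∀ n → half^ n ≤ 1ℚ
half^≤1 zero    = ≤-refl
half^≤1 (suc n) = *-mono {½} {1ℚ} (<⇒≤ (0<half^ n)) (nonNegative⁻¹ 1ℚ)
  (from-yes (½ ≤? 1ℚ)) (half^≤1 n)

half^*n≤1 : ∀ n → half^ n * ℕ→ℚ n ≤ 1ℚ
half^*n≤1 zero    = from-yes (1ℚ * ℕ→ℚ 0 ≤? 1ℚ)
half^*n≤1 (suc n) = subst₂ _≤_ eq (½+½ 1ℚ)
  (+-mono-≤ (*-monoˡ-≤-nonNeg ½ (half^≤1 n)) (*-monoˡ-≤-nonNeg ½ (half^*n≤1 n)))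
  where
  open +-*-Solver
  eq : ½ * half^ n + ½ * (half^ n * ℕ→ℚ n) ≡ half^ (suc n) * ℕ→ℚ (suc n)
  eq = trans
    (solve 3 (λ a b c → a :* b :+ a :* (b :* c) := (a :* b) :* (con 1ℚ :+ c)) refl
      ½ (half^ n) (ℕ→ℚ n))
    (cong (½ * half^ n *_) (sym (ℕ→ℚ-suc n)))

half^-antitone : ∀ {m n} → m ℕ.≤′ n → half^ n ≤ half^ m
half^-antitone ℕ.≤′-refl = ≤-refl
half^-antitone {m} {suc n} (ℕ.≤′-step m≤n) =
  ≤-trans (subst (½ * half^ n ≤_) (*-identityˡ (half^ n))
    (*-monoʳ-≤-nonNeg (half^ n) {{nonNegative (<⇒≤ (0<half^ n))}} (from-yes (½ ≤? 1ℚ))))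
    (half^-antitone m≤n)

half^-null : Null₁.Null half^
half^-null ε 0<ε =
  let M , h = <-ℕ→ℚ (1/ ε) in M , λ n M≤n →
    subst (_< ε) (sym (0≤p⇒∣p∣≡p (<⇒≤ (0<half^ n))))
      (≤-<-trans (half^-antitone (ℕₚ.≤⇒≤′ M≤n)) (small M h))
  where
  instance
    ε-pos = positive 0<ε
    ε-nonZero = pos⇒nonZero ε
  small : ∀ M → 1/ ε < ℕ→ℚ M → half^ M < ε
  small M h = subst₂ _<_ eq (*-identityˡ ε) (*-monoˡ-<-pos ε
    (<-≤-trans (*-monoʳ-<-pos (half^ M) {{positive (0<half^ M)}} h) (half^*n≤1 M)))
    where
    eq : half^ M * (1/ ε) * ε ≡ half^ M
    eq = trans (*-assoc (half^ M) (1/ ε) ε)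
           (trans (cong (half^ M *_) (*-inverseˡ ε)) (*-identityʳ (half^ M)))

width≡ : ∀ q n → width q n ≡ half^ n * (q + 1ℚ)
width≡ q zero    = sym (*-identityˡ (q + 1ℚ))
width≡ q (suc n) = trans (cong (½ *_) (width≡ q n)) (sym (*-assoc ½ (half^ n) (q + 1ℚ)))

const-bounded : ∀ c → Null₁.Bounded (λ _ → c)
const-bounded c = ∣ c ∣ + 1ℚ , +-mono-≤-< (0≤∣p∣ c) (positive⁻¹ 1ℚ) , 0 , λ _ _ →
  subst (_≤ ∣ c ∣ + 1ℚ) (+-identityʳ ∣ c ∣) (+-monoʳ-≤ ∣ c ∣ (<⇒≤ (positive⁻¹ 1ℚ)))

width-null : ∀ q → Null₁.Null (width q)
width-null q = Null₁.null-resp (λ n → sym (width≡ q n))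
  (Null₁.null-* half^-null (const-bounded (q + 1ℚ)))

0≤width : ∀ {q} → 0ℚ ≤ q → ∀ n → 0ℚ ≤ width q n
0≤width 0≤q zero    = +-mono-≤ 0≤q (nonNegative⁻¹ 1ℚ)
0≤width 0≤q (suc n) = *-nonNeg (<⇒≤ 0<½) (0≤width 0≤q n)

lower-bounds : ∀ {q} → 0ℚ ≤ q → ∀ n →
  let l = lower q n ; u = l + width q n in
  0ℚ ≤ l × l * l ≤ q × q < u * u
lower-bounds {q} 0≤q zero = ≤-refl , 0≤q , subst (λ u → q < u * u)
    (sym (+-identityˡ (q + 1ℚ)))
    (<-≤-trans q<q+1 (subst (_≤ (q + 1ℚ) * (q + 1ℚ)) (*-identityˡ (q + 1ℚ))
      (*-monoʳ-≤-nonNeg (q + 1ℚ) {{nonNegative (0≤width 0≤q 0)}} 1≤q+1)))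
  where
  q<q+1 : q < q + 1ℚ
  q<q+1 = subst (_< q + 1ℚ) (+-identityʳ q) (+-monoʳ-< q (positive⁻¹ 1ℚ))
  1≤q+1 : 1ℚ ≤ q + 1ℚ
  1≤q+1 = +-monoˡ-≤ 1ℚ 0≤q
lower-bounds {q} 0≤q (suc n) = step (mid * mid ≤? q)
  where
  l w mid : ℚ
  l   = lower q n
  w   = width q (suc n)
  mid = l + w
  IH = lower-bounds 0≤q n
  eq : l + width q n ≡ mid + w
  eq = trans (cong (l +_) (sym (½+½ (width q n)))) (sym (+-assoc l w w))
  step : (d : Dec (mid * mid ≤ q)) →
    let l′ = if does d then mid else l ; u′ = l′ + w in
    0ℚ ≤ l′ × l′ * l′ ≤ q × q < u′ * u′
  step (yes m²≤q) = +-mono-≤ {0ℚ} {l} {0ℚ} {w} (proj₁ IH) (0≤width 0≤q (suc n))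
                  , m²≤q
                  , subst (λ u → q < u * u) eq (proj₂ (proj₂ IH))
  step (no m²≰q)  = proj₁ IH , proj₁ (proj₂ IH) , ≰⇒> m²≰q

0≤p*p : ∀ p → 0ℚ ≤ p * p
0≤p*p p with ∣p∣≡p∨∣p∣≡-p p
... | inj₁ e = subst (λ r → 0ℚ ≤ r * r) e (*-nonNeg (0≤∣p∣ p) (0≤∣p∣ p))
... | inj₂ e = subst (0ℚ ≤_) (trans (cong (λ r → r * r) e) (neg*neg p))
                 (*-nonNeg (0≤∣p∣ p) (0≤∣p∣ p))
  where
  open +-*-Solver
  neg*neg : ∀ p → (- p) * (- p) ≡ p * p
  neg*neg = solve 1 (λ p → (:- p) :* (:- p) := p :* p) refl

lower-neg : ∀ {q} → ¬ 0ℚ ≤ q → ∀ n → lower q n ≡ 0ℚ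
lower-neg 0≰q zero = refl
lower-neg {q} 0≰q (suc n) = step (mid * mid ≤? q)
  where
  mid = lower q n + width q (suc n)
  step : (d : Dec (mid * mid ≤ q)) → (if does d then mid else lower q n) ≡ 0ℚ
  step (yes m²≤q) = contradiction (≤-trans (0≤p*p mid) m²≤q) 0≰q
  step (no _)     = lower-neg 0≰q n

lower<upper : ∀ {q} → 0ℚ ≤ q → ∀ m n → lower q m < lower q n + width q n
lower<upper {q} 0≤q m n =
  let _   , l²≤q , _    = lower-bounds 0≤q m
      0≤l , _    , q<u² = lower-bounds 0≤q n
  in square-cancel-< (+-mono-≤ {0ℚ} {lower q n} {0ℚ} 0≤l (0≤width 0≤q n)) (≤-<-trans l²≤q q<u²)

∣∣<-intro : ∀ {p ε} → p < ε → - p < ε → ∣ p ∣ < ε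
∣∣<-intro {p} {ε} p<ε -p<ε with ∣p∣≡p∨∣p∣≡-p p
... | inj₁ e = subst (_< ε) (sym e) p<ε
... | inj₂ e = subst (_< ε) (sym e) -p<ε

∣∣<⇒< : ∀ {p ε} → 0ℚ ≤ p → ∣ p ∣ < ε → p < ε
∣∣<⇒< {ε = ε} 0≤p = subst (_< ε) (0≤p⇒∣p∣≡p 0≤p)

<+⇒-< : ∀ {a b w} → a < b + w → a - b < w
<+⇒-< {a} {b} {w} lt = subst (a - b <_) (cancel b w) (+-monoˡ-< (- b) lt)
  where
  open +-*-Solver
  cancel : ∀ b w → b + w - b ≡ w
  cancel = solve 2 (λ b w → b :+ w :- b := w) refl

lower-cauchy : ∀ q → Null₂.Null (λ (m , n) → lower q m - lower q n)
lower-cauchy q with 0ℚ ≤? q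
... | no 0≰q = Null₂.null-0 λ (m , n) → cong₂ _-_ (lower-neg 0≰q m) (lower-neg 0≰q n)
... | yes 0≤q = λ ε 0<ε →
  let N , h = width-null q ε 0<ε in N , λ (m , n) (N≤m , N≤n) →
    ∣∣<-intro
      (<-trans (<+⇒-< (lower<upper 0≤q m n)) (∣∣<⇒< (0≤width 0≤q n) (h n N≤n)))
      (subst (_< ε) (sym (swap-rearrange (lower q m) (lower q n)))
        (<-trans (<+⇒-< (lower<upper 0≤q n m)) (∣∣<⇒< (0≤width 0≤q m) (h m N≤m))))

√ : ℚ → ℝ
√ q = mkℝ (lower q) (lower-cauchy q)

√-nonNegative : ∀ {q} → 0ℚ ≤ q → ∀ n → 0ℚ ≤ seq (√ q) n
√-nonNegative 0≤q n = proj₁ (lower-bounds 0≤q n)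

√-square : ∀ {q} → 0ℚ ≤ q → √ q *ᴿ √ q ≈ fromℚ q
√-square {q} 0≤q ε 0<ε =
  let N , h = Null₁.null-* (width-null q) bounded ε 0<ε in N , λ n N≤n →
    let l = lower q n
        w = width q n
        0≤l , l²≤q , q<u² = lower-bounds 0≤q n
        0≤w = 0≤width 0≤q n
        gap<ε = ∣∣<⇒< (*-nonNeg 0≤w (+-mono-≤ {0ℚ} {l + l} {0ℚ} (+-mono-≤ {0ℚ} {l} {0ℚ} 0≤l 0≤l) 0≤w)) (h n N≤n)
    in ∣∣<-intro
         (≤-<-trans (subst (l * l - q ≤_) (+-inverseʳ q) (+-monoˡ-≤ (- q) l²≤q)) 0<ε)
         (subst (_< ε) (sym (swap-rearrange (l * l) q))
           (<-trans (<+⇒-< (subst (q <_) (expand l w) q<u²)) gap<ε))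
  where
  open +-*-Solver
  expand : ∀ l w → (l + w) * (l + w) ≡ l * l + w * (l + l + w)
  expand = solve 2 (λ l w → (l :+ w) :* (l :+ w) := l :* l :+ w :* (l :+ l :+ w)) refl
  widthᴿ : ℝ
  widthᴿ = mkℝ (width q) λ ε 0<ε →
    let N , h = width-null q (½ * ε) (0<* 0<½ 0<ε) in N , λ (m , n) (N≤m , N≤n) →
      ≤-<-trans (∣p-q∣≤∣p∣+∣q∣ (width q m) (width q n))
        (subst (∣ width q m ∣ + ∣ width q n ∣ <_) (½+½ ε) (+-mono-< (h m N≤m) (h n N≤n)))
  bounded : Null₁.Bounded (λ n → lower q n + lower q n + width q n)
  bounded = seq-bounded (√ q +ᴿ √ q +ᴿ widthᴿ)

------------------------------------------------------------------------
-- Graphs and the normalized Laplacian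

infixl 7 _÷ₙ_

-- Division by 0 gives 0; below, the denominators that matter are positive.
_÷ₙ_ : ℕ → ℕ → ℚ
m ÷ₙ zero  = 0ℚ
m ÷ₙ suc n = ℤ.+ m / suc n

record Graph : Set₁ where
  infix 4 _~_ _~?_ _≟ᵛ_
  field
    order    : ℕ
    Vertex   : Set
    vertices : Fin order ↔ Vertex
    _~_      : Rel Vertex 0ℓ
    _~?_     : Decidable _~_
    ~-irrefl : Irreflexive _≡_ _~_
    ~-sym    : Symmetric _~_

  vertex : Fin order → Vertex
  vertex = Inverse.to vertices

  _≟ᵛ_ : DecidableEquality Vertex
  _≟ᵛ_ = via-injection (↔⇒↣ (↔-sym vertices)) _≟ᶠ_

  degree : Vertex → ℕ
  degree u = count (λ i → u ~? vertex i) (allFin order)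

  ∑ᵛ : (Vertex → ℝ) → ℝ
  ∑ᵛ f = sum (λ i → f (vertex i))

  -- The entry -1/√(d_u d_v) is written -√(1/(d_u d_v)), so that no
  -- reciprocal on ℝ is needed.
  ℒ : Vertex → Vertex → ℝ
  ℒ u v =
    if does (u ≟ᵛ v) then
      (if does (degree u ℕₚ.≟ 0) then fromℚ 0ℚ else fromℚ 1ℚ)
    else if does (u ~? v) then
      -ᴿ √ (1 ÷ₙ (degree u ℕ.* degree v))
    else fromℚ 0ℚ

  IsEigenvalue : (Vertex → Vertex → ℝ) → ℝ → Set
  IsEigenvalue M θ = Σ[ x ∈ (Vertex → ℝ) ]
    ¬ (∀ u → x u ≈ fromℚ 0ℚ) ×
    (∀ u → ∑ᵛ (λ w → M u w *ᴿ x w) ≈ θ *ᴿ x u)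

  -- The list θs enumerates the ℒ-eigenvalues, each exactly once.
  DistinctℒEigenvalues : List ℝ → Set
  DistinctℒEigenvalues θs = Unique θs × (∀ θ → IsEigenvalue ℒ θ ⇔ θ ∈ θs)
    where
    open SetoidMembership ℝ-ring.setoid using (_∈_)
    open SetoidUnique ℝ-ring.setoid using (Unique)

------------------------------------------------------------------------
-- Projective planes and the graph of a plane with repeated lines

record ProjectivePlane (k v : ℕ) : Set₁ where
  infix 4 _I_ _I?_

  field
    2≤k         : 2 ℕ.≤ k
    v≡k²-k+1    : v ≡ k ℕ.* k ℕ.∸ k ℕ.+ 1
    _I_         : REL (Fin v) (Fin v) 0ℓ     -- points, lines
    _I?_        : Decidable _I_
    line-size   : ∀ ℓ → count (λ p → p I? ℓ) (allFin v) ≡ k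
    point-size  : ∀ p → count (λ ℓ → p I? ℓ) (allFin v) ≡ k
    unique-line : ∀ {p q} → p ≢ q → ∃! _≡_ (λ ℓ → p I ℓ × q I ℓ)

  Point Line : Set
  Point = Fin v
  Line  = Fin v

module RepeatedLines {k v : ℕ} (Π : ProjectivePlane k v) (lam : ℕ) where
  open ProjectivePlane Π

  -- (ℓ , i) is the i-th copy of the line ℓ.
  Block : Set
  Block = Line × Fin lam

  _≟ᴮ_ : DecidableEquality Block
  _≟ᴮ_ = ≡-dec _≟ᶠ_ _≟ᶠ_

  infix 4 _⋈_ _⋈?_

  _⋈_ : Rel (Point ⊎ Block) 0ℓ
  inj₁ p ⋈ inj₁ q = p ≢ q
  inj₁ p ⋈ inj₂ (ℓ , _) = p I ℓ
  inj₂ (ℓ , _) ⋈ inj₁ p = p I ℓ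
  inj₂ b@(ℓ , _) ⋈ inj₂ c@(m , _) = b ≢ c × ℓ ≡ m

  _⋈?_ : Decidable _⋈_
  inj₁ p ⋈? inj₁ q = ¬? (p ≟ᶠ q)
  inj₁ p ⋈? inj₂ (ℓ , _) = p I? ℓ
  inj₂ (ℓ , _) ⋈? inj₁ p = p I? ℓ
  inj₂ b@(ℓ , _) ⋈? inj₂ c@(m , _) = ¬? (b ≟ᴮ c) ×-dec (ℓ ≟ᶠ m)

  ⋈-irrefl : Irreflexive _≡_ _⋈_
  ⋈-irrefl {inj₁ _} refl p≢p = p≢p refl
  ⋈-irrefl {inj₂ _} refl (b≢b , _) = b≢b refl

  ⋈-sym : Symmetric _⋈_
  ⋈-sym {inj₁ _} {inj₁ _} p≢q = p≢q ∘ sym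
  ⋈-sym {inj₁ _} {inj₂ _} pIℓ = pIℓ
  ⋈-sym {inj₂ _} {inj₁ _} pIℓ = pIℓ
  ⋈-sym {inj₂ _} {inj₂ _} (b≢c , ℓ≡m) = b≢c ∘ sym , sym ℓ≡m

  Γ : Graph
  Γ = record
    { order    = v ℕ.+ v ℕ.* lam
    ; Vertex   = Point ⊎ Block
    ; vertices = (↔-id Point ⊎-↔ *↔×) ↔-∘ +↔⊎
    ; _~_      = _⋈_
    ; _~?_     = _⋈?_
    ; ~-irrefl = ⋈-irrefl
    ; ~-sym    = λ {x} {y} → ⋈-sym {x} {y}
    }

{-# OPTIONS --safe #-}

-- Write a vector on Γ as (f, g), its values on the points and on the blocks, and let N be the
-- incidence matrix of the plane.  If (f, g) is an eigenvector for θ, then eliminating g by means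
-- of N Nᵀ = (k - 1) I + J leaves (θ - θ₂) ((θ - θ₁) f + ρ ∑ f) = 0 with ρ = 1/(k (k + λ - 1)), and
-- summing over the points gives θ (θ - θ₂) ∑ f = 0.  So if θ is none of 0, θ₁, θ₂, then f = 0; the
-- sums of g over the copies of each line are then in the kernel of N, which is trivial because
-- Nᵀ N = (k - 1) I + J as well, and g = 0 follows.
-- Conversely, the square roots of the degrees form an eigenvector for 0; any f with ∑ f = 0,
-- extended to the blocks by a multiple of Nᵀ f, gives one for θ₁; and so does, for θ₂, any vector
-- on the blocks that sums to 0 over the copies of each line.
-- That θ is one of the three values is a disjunction, decided by a rational approximation of θ.

module Submission where

open import Algebra.Bundles using (CommutativeRing; CommutativeSemiring)
import Algebra.Properties.AbelianGroup
import Algebra.Properties.Group as GroupProperties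
import Algebra.Properties.Ring
import Algebra.Properties.Semiring.Mult as SemiringMult
import Algebra.Properties.Semiring.Mult.TCOptimised
import Algebra.Properties.Semiring.Sum as SemiringSum
import Algebra.Solver.Ring as RingSolver
open import Algebra.Solver.Ring.AlmostCommutativeRing using (fromCommutativeRing; _-Raw-AlmostCommutative⟶_)
open import Data.Bool.Base using (true; false; if_then_else_)
open import Data.Empty using (⊥; ⊥-elim)
open import Data.Fin.Base using (Fin; zero; suc; _↑ˡ_; _↑ʳ_; combine; remQuot)
open import Data.Fin.Properties using (any?; splitAt-↑ˡ; splitAt-↑ʳ; remQuot-combine)
  renaming (_≟_ to _≟ᶠ_; suc-injective to suc-injectiveᶠ)
import Data.Integer.Base as ℤ
import Data.Integer.Properties as ℤₚ
open import Data.List.Base using ([]; _∷_)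
import Data.List.Membership.Setoid as SetoidMembership
open import Data.List.Relation.Unary.All using ([]; _∷_)
open import Data.List.Relation.Unary.AllPairs using ([]; _∷_)
open import Data.List.Relation.Unary.Any using (here; there)
import Data.List.Relation.Unary.Unique.Setoid as SetoidUnique
open import Data.Maybe.Base using (map)
open import Data.Nat.Base as ℕ using (ℕ; zero; suc; z≤n; s≤s)
import Data.Nat.Properties as ℕₚ
open import Data.Product using (∃!; ∃-syntax; ∃₂; Σ-syntax; _×_; _,_; proj₁; proj₂)
open import Data.Rational.Base as ℚ using (ℚ; 0ℚ; 1ℚ; ½)
import Data.Rational.Properties as ℚₚ
open import Data.Rational.Solver using (module +-*-Solver)
import Data.Rational.Unnormalised.Base as ℚᵘ
import Data.Rational.Unnormalised.Properties as ℚᵘₚ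
import Data.Sign.Base as Sign
open import Data.Sum.Base as Sum using (_⊎_; inj₁; inj₂)
open import Data.Vec.Base using (count; allFin; tabulate)
open import Function.Base using (_∘_; id)
open import Function.Bundles using (Inverse; _⇔_; mk⇔)
open import Level using (0ℓ)
open import Relation.Binary.Core using (REL)
import Relation.Binary.Definitions as B
open import Relation.Binary.PropositionalEquality as ≡ using (_≡_; _≢_)
import Relation.Binary.Reasoning.Setoid as SetoidReasoning
open import Relation.Nullary using (¬_; Dec; yes; no; does; ¬?; contradiction)
open import Relation.Nullary.Decidable using (_×-dec_; dec-true; dec-false; dec⇒maybe)
open import Relation.Unary using (Decidable)

open import Defs using (Graph; module Graph; ProjectivePlane; module ProjectivePlane; module RepeatedLines)

-- Two obstacles shape the proof. The first is division. To express the block values through f one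
-- would divide by `κ * β - θ`, where β = 1/(k + λ - 1), but nothing excludes θ = k β. The
-- elimination therefore multiplies the point equation by this factor, and the block values are
-- recovered later from the kernel of N. No division remains: besides the plane, the computation
-- over a commutative ring uses only the relations k ρ = β, (k + λ - 1) β = 1, σ² = ρ β and c (k -
-- 1) = 1, with the inverses and the root supplied as elements. That Nᵀ N = (k - 1) I + J is not
-- immediate either: it needs any two lines to meet, which is no axiom here and follows by counting
-- from v = k² - k + 1. The second obstacle is that equality of reals is not decidable. An
-- eigenvalue θ yields only a contradiction from its differing from all three values. Approximation
-- separates θ from two of three distinct rationals, and equality with the third follows because
-- equality of reals is stable under double negation.

-- Polynomial identities in a commutative ring

module IntegerCoefficients (R : CommutativeRing 0ℓ 0ℓ) where
  open CommutativeRing R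
  open Algebra.Properties.Ring ring using (-‿distribˡ-*; -‿distribʳ-*; -‿involutive; -0#≈0#)
  open Algebra.Properties.AbelianGroup +-abelianGroup using (⁻¹-∙-comm)
  open Algebra.Properties.Semiring.Mult.TCOptimised semiring using (1+×; ×-homo-+; ×1-homo-*) renaming (_×_ to _·_)
  open SetoidReasoning setoid

  -- The solver has to decide equality of coefficients, which an arbitrary ring, and ℝ in
  -- particular, does not allow; integer coefficients do.
  ⟦_⟧ : ℤ.ℤ → Carrier
  ⟦ ℤ.+ n ⟧      = n · 1#
  ⟦ ℤ.-[1+ n ] ⟧ = - (suc n · 1#)

  ⟦⟧-homo-neg : ∀ i → ⟦ ℤ.- i ⟧ ≈ - ⟦ i ⟧
  ⟦⟧-homo-neg (ℤ.+ zero)   = sym -0#≈0#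
  ⟦⟧-homo-neg (ℤ.+ suc n)  = refl
  ⟦⟧-homo-neg ℤ.-[1+ n ]   = sym (-‿involutive _)

  ⟦⟧-homo-⊖ : ∀ m n → ⟦ m ℤ.⊖ n ⟧ ≈ m · 1# - n · 1#
  ⟦⟧-homo-⊖ zero    zero    = sym (-‿inverseʳ 0#)
  ⟦⟧-homo-⊖ zero    (suc n) = sym (+-identityˡ _)
  ⟦⟧-homo-⊖ (suc m) zero    = sym (trans (+-congˡ -0#≈0#) (+-identityʳ _))
  ⟦⟧-homo-⊖ (suc m) (suc n) = begin
    ⟦ suc m ℤ.⊖ suc n ⟧                ≡⟨ ≡.cong ⟦_⟧ (ℤₚ.[1+m]⊖[1+n]≡m⊖n m n) ⟩
    ⟦ m ℤ.⊖ n ⟧                        ≈⟨ ⟦⟧-homo-⊖ m n ⟩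
    a - b                              ≈⟨ +-congʳ (trans (+-congʳ (-‿inverseʳ 1#)) (+-identityˡ a)) ⟨
    ((1# - 1#) + a) - b                ≈⟨ +-congʳ (trans (+-assoc _ _ _) (trans (+-congˡ (+-comm _ _)) (sym (+-assoc _ _ _)))) ⟩
    ((1# + a) - 1#) - b                ≈⟨ +-assoc _ _ _ ⟩
    (1# + a) + (- 1# - b)              ≈⟨ +-congˡ (⁻¹-∙-comm 1# b) ⟩
    (1# + a) - (1# + b)                ≈⟨ +-cong (1+× m 1#) (-‿cong (1+× n 1#)) ⟨
    suc m · 1# - suc n · 1#            ∎
    where
    a = m · 1#
    b = n · 1#

  ⟦⟧-homo-+ : ∀ i j → ⟦ i ℤ.+ j ⟧ ≈ ⟦ i ⟧ + ⟦ j ⟧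
  ⟦⟧-homo-+ (ℤ.+ m)    (ℤ.+ n)    = ×-homo-+ 1# m n
  ⟦⟧-homo-+ (ℤ.+ m)    ℤ.-[1+ n ] = ⟦⟧-homo-⊖ m (suc n)
  ⟦⟧-homo-+ ℤ.-[1+ m ] (ℤ.+ n)    = trans (⟦⟧-homo-⊖ n (suc m)) (+-comm _ _)
  ⟦⟧-homo-+ ℤ.-[1+ m ] ℤ.-[1+ n ] = begin
    - ((2 ℕ.+ (m ℕ.+ n)) · 1#)          ≡⟨ ≡.cong (λ k → - (suc k · 1#)) (+-suc m n) ⟨
    - ((suc m ℕ.+ suc n) · 1#)          ≈⟨ -‿cong (×-homo-+ 1# (suc m) (suc n)) ⟩
    - (suc m · 1# + suc n · 1#)         ≈⟨ ⁻¹-∙-comm _ _ ⟨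
    - (suc m · 1#) - suc n · 1#         ∎
    where open import Data.Nat.Properties using (+-suc)

  ⟦⟧-homo-◃⁺ : ∀ n → ⟦ Sign.+ ℤ.◃ n ⟧ ≈ n · 1#
  ⟦⟧-homo-◃⁺ zero    = refl
  ⟦⟧-homo-◃⁺ (suc n) = refl

  ⟦⟧-homo-◃⁻ : ∀ n → ⟦ Sign.- ℤ.◃ n ⟧ ≈ - (n · 1#)
  ⟦⟧-homo-◃⁻ zero    = sym -0#≈0#
  ⟦⟧-homo-◃⁻ (suc n) = refl

  ⟦⟧-homo-* : ∀ i j → ⟦ i ℤ.* j ⟧ ≈ ⟦ i ⟧ * ⟦ j ⟧
  ⟦⟧-homo-* (ℤ.+ m)    (ℤ.+ n)    = trans (⟦⟧-homo-◃⁺ (m ℕ.* n)) (×1-homo-* m n)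
  ⟦⟧-homo-* (ℤ.+ m)    ℤ.-[1+ n ] = trans (⟦⟧-homo-◃⁻ (m ℕ.* suc n))
    (trans (-‿cong (×1-homo-* m (suc n))) (-‿distribʳ-* _ _))
  ⟦⟧-homo-* ℤ.-[1+ m ] (ℤ.+ n)    = trans (⟦⟧-homo-◃⁻ (suc m ℕ.* n))
    (trans (-‿cong (×1-homo-* (suc m) n)) (-‿distribˡ-* _ _))
  ⟦⟧-homo-* ℤ.-[1+ m ] ℤ.-[1+ n ] = begin
    (suc m ℕ.* suc n) · 1#              ≈⟨ ×1-homo-* (suc m) (suc n) ⟩
    (suc m · 1#) * (suc n · 1#)         ≈⟨ -‿involutive _ ⟨
    - (- ((suc m · 1#) * (suc n · 1#))) ≈⟨ -‿cong (-‿distribˡ-* _ _) ⟩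
    - ((- (suc m · 1#)) * (suc n · 1#)) ≈⟨ -‿distribʳ-* _ _ ⟩
    (- (suc m · 1#)) * (- (suc n · 1#)) ∎

  morphism : ℤ.+-*-rawRing -Raw-AlmostCommutative⟶ fromCommutativeRing R
  morphism = record
    { ⟦_⟧    = ⟦_⟧
    ; +-homo = ⟦⟧-homo-+
    ; *-homo = ⟦⟧-homo-*
    ; -‿homo = ⟦⟧-homo-neg
    ; 0-homo = refl
    ; 1-homo = refl
    }

  open RingSolver ℤ.+-*-rawRing (fromCommutativeRing R) morphism
    (λ i j → map (λ i≡j → reflexive (≡.cong ⟦_⟧ i≡j)) (dec⇒maybe (i ℤₚ.≟ j))) public
    using (Polynomial; solve; _:=_; _:+_; _:*_; _:-_; :-_; con)

  1′ : ∀ {n} → Polynomial n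
  1′ = con (ℤ.+ 1)

  -- Equations are proved by writing the difference of their sides as a
  -- linear combination of the differences of equations already known.
  infixr 7 _⊛_
  infixl 6 _⊞_

  _⊛_ : ∀ c {x y} → x ≈ y → c * (x - y) ≈ 0#
  c ⊛ x≈y = trans (*-congˡ (trans (+-congʳ x≈y) (-‿inverseʳ _))) (zeroʳ c)

  _⊞_ : ∀ {x y} → x ≈ 0# → y ≈ 0# → x + y ≈ 0#
  x≈0 ⊞ y≈0 = trans (+-cong x≈0 y≈0) (+-identityˡ 0#)

  by-combination : ∀ {x y z} → x ≈ y + z → z ≈ 0# → x ≈ y
  by-combination x≈y+z z≈0 = trans x≈y+z (trans (+-congˡ z≈0) (+-identityʳ _))

-- Finite sums and indicators over a commutative semiring

module Sums (S : CommutativeSemiring 0ℓ 0ℓ) where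
  open CommutativeSemiring S hiding (zero)
  open SemiringSum semiring public
  open SemiringMult semiring public using (×-homo-+; ×-assoc-*; ×1-homo-*) renaming (_×_ to _·_)
  open SetoidReasoning setoid

  [_] : ∀ {A : Set} → Dec A → Carrier
  [ a? ] = if does a? then 1# else 0#

  module _ {A : Set} (a? : Dec A) where

    [_]≈1 : A → [ a? ] ≈ 1#
    [_]≈1 a = reflexive (≡.cong (if_then 1# else 0#) (dec-true a? a))

    [_]≈0 : ¬ A → [ a? ] ≈ 0#
    [_]≈0 ¬a = reflexive (≡.cong (if_then 1# else 0#) (dec-false a? ¬a))

  sum-0 : ∀ {n} {f : Fin n → Carrier} → (∀ i → f i ≈ 0#) → sum f ≈ 0#
  sum-0 {n} f≈0 = trans (sum-cong-≋ f≈0) (sum-replicate-zero n)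

  sum-const : ∀ n x → sum {n} (λ _ → x) ≈ (n · 1#) * x
  sum-const n x = begin
    sum {n} (λ _ → x) ≈⟨ sum-replicate n ⟩
    n · x             ≈⟨ ×-congʳ n (*-identityˡ x) ⟨
    n · (1# * x)      ≈⟨ ×-assoc-* n 1# x ⟨
    (n · 1#) * x      ∎
    where open SemiringMult semiring using (×-congʳ)

  sum-single : ∀ {n} (f : Fin n → Carrier) i → (∀ j → j ≢ i → f j ≈ 0#) → sum f ≈ f i
  sum-single f zero    f≈0 = trans (+-congˡ (sum-0 (λ j → f≈0 (suc j) λ ()))) (+-identityʳ _)
  sum-single f (suc i) f≈0 = trans (+-cong (f≈0 zero λ ())
    (sum-single (f ∘ suc) i (λ j j≢i → f≈0 (suc j) (j≢i ∘ suc-injectiveᶠ)))) (+-identityˡ _)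

  sum-δ : ∀ {n} i (f : Fin n → Carrier) → sum (λ j → [ i ≟ᶠ j ] * f j) ≈ f i
  sum-δ i f = begin
    sum (λ j → [ i ≟ᶠ j ] * f j) ≈⟨ sum-single _ i (λ j j≢i →
                                      trans (*-congʳ ([ i ≟ᶠ j ]≈0 (j≢i ∘ ≡.sym))) (zeroˡ _)) ⟩
    [ i ≟ᶠ i ] * f i             ≈⟨ trans (*-congʳ ([ i ≟ᶠ i ]≈1 ≡.refl)) (*-identityˡ _) ⟩
    f i                          ∎

  -- The axioms of the plane and the degrees are given as `count`s; this makes them available as
  -- sums of indicators, over ℕ and over the ring alike.
  count-tabulate : ∀ {A : Set} {P : A → Set} (P? : Decidable P) {n} (g : Fin n → A) →
    count P? (tabulate g) · 1# ≈ sum (λ i → [ P? (g i) ])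
  count-tabulate P? {zero}  g = refl
  count-tabulate P? {suc n} g with does (P? (g zero))
  ... | true  = +-congˡ (count-tabulate P? (g ∘ suc))
  ... | false = trans (count-tabulate P? (g ∘ suc)) (sym (+-identityˡ _))

  sum-↑ : ∀ m {n} (f : Fin (m ℕ.+ n) → Carrier) →
    sum f ≈ sum (λ i → f (i ↑ˡ n)) + sum (λ j → f (m ↑ʳ j))
  sum-↑ zero    f = sym (+-identityˡ _)
  sum-↑ (suc m) f = trans (+-congˡ (sum-↑ m (f ∘ suc))) (sym (+-assoc _ _ _))

  sum-combine : ∀ m {n} (f : Fin (m ℕ.* n) → Carrier) →
    sum f ≈ sum (λ i → sum (λ j → f (combine {m} {n} i j)))
  sum-combine zero        f = refl
  sum-combine (suc m) {n} f = trans (sum-↑ n f) (+-congˡ (sum-combine m (λ i → f (n ↑ʳ i))))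

  sum-*-assoc : ∀ {m n} (w : Fin m → Carrier) (M : Fin m → Fin n → Carrier) (x : Fin n → Carrier) →
    sum (λ i → w i * sum (λ j → M i j * x j)) ≈ sum (λ j → sum (λ i → w i * M i j) * x j)
  sum-*-assoc w M x = begin
    sum (λ i → w i * sum (λ j → M i j * x j))   ≈⟨ sum-cong-≋ (λ i → trans (*-distribˡ-sum (w i) (λ j → M i j * x j))
                                                     (sum-cong-≋ (λ j → sym (*-assoc (w i) (M i j) (x j))))) ⟩
    sum (λ i → sum (λ j → w i * M i j * x j))   ≈⟨ ∑-comm (λ i j → w i * M i j * x j) ⟩
    sum (λ j → sum (λ i → w i * M i j * x j))   ≈⟨ sum-cong-≋ (λ j → sym (*-distribʳ-sum (x j) (λ i → w i * M i j))) ⟩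
    sum (λ j → sum (λ i → w i * M i j) * x j)   ∎

-- The Gram matrix of the plane

-- A projective plane, with _J_ either incidence (rows are points) or its converse (rows are lines).
record SquareDesign (k v : ℕ) (_J_ : REL (Fin v) (Fin v) 0ℓ) : Set where
  field
    _J?_        : B.Decidable _J_
    row-size    : ∀ a → count (a J?_) (allFin v) ≡ k
    column-size : ∀ j → count (_J? j) (allFin v) ≡ k
    unique-meet : ∀ {a b} → a ≢ b → ∃! _≡_ (λ j → a J j × b J j)

module Gram (S : CommutativeSemiring 0ℓ 0ℓ) {k v : ℕ} {_J_ : REL (Fin v) (Fin v) 0ℓ} (𝒟 : SquareDesign k v _J_) where
  open CommutativeSemiring S hiding (zero)
  open Sums S
  open SquareDesign 𝒟
  open SetoidReasoning setoid

  row-sum : ∀ a → sum (λ j → [ a J? j ]) ≈ k · 1#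
  row-sum a = trans (sym (count-tabulate (a J?_) id)) (reflexive (≡.cong (_· 1#) (row-size a)))

  column-sum : ∀ j → sum (λ a → [ a J? j ]) ≈ k · 1#
  column-sum j = trans (sym (count-tabulate (_J? j) id)) (reflexive (≡.cong (_· 1#) (column-size j)))

  -- N Nᵀ = (k - 1) I + J, with I moved to the left so that no subtraction occurs. An off-diagonal
  -- entry is 1 because exactly one column meets both rows.
  gram : ∀ a b → sum (λ j → [ a J? j ] * [ b J? j ]) + [ a ≟ᶠ b ] ≈ 1# + (k · 1#) * [ a ≟ᶠ b ]
  gram a b with a ≟ᶠ b
  ... | yes ≡.refl = begin
    sum (λ j → [ a J? j ] * [ a J? j ]) + 1# ≈⟨ +-congʳ (trans (sum-cong-≋ (λ j → idem (a J? j))) (row-sum a)) ⟩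
    k · 1# + 1#                              ≈⟨ +-comm _ _ ⟩
    1# + k · 1#                              ≈⟨ +-congˡ (*-identityʳ _) ⟨
    1# + (k · 1#) * 1#                       ∎
    where
    idem : ∀ {A : Set} (a? : Dec A) → [ a? ] * [ a? ] ≈ [ a? ]
    idem (yes _) = *-identityˡ _
    idem (no _)  = zeroˡ _
  ... | no a≢b =
    let j , (aJj , bJj) , unique = unique-meet a≢b in begin
    sum (λ j → [ a J? j ] * [ b J? j ]) + 0# ≈⟨ +-identityʳ _ ⟩
    sum (λ j → [ a J? j ] * [ b J? j ])      ≈⟨ sum-single _ j (λ i i≢j →
                                                  both (a J? i) (b J? i) (λ ab → i≢j (≡.sym (unique ab)))) ⟩
    [ a J? j ] * [ b J? j ]                  ≈⟨ trans (*-cong ([ a J? j ]≈1 aJj) ([ b J? j ]≈1 bJj)) (*-identityˡ _) ⟩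
    1#                                       ≈⟨ +-identityʳ _ ⟨
    1# + 0#                                  ≈⟨ +-congˡ (zeroʳ _) ⟨
    1# + (k · 1#) * 0#                       ∎
    where
    both : ∀ {A B : Set} (a? : Dec A) (b? : Dec B) → ¬ (A × B) → [ a? ] * [ b? ] ≈ 0#
    both (yes a) b? ¬ab = trans (*-congˡ ([ b? ]≈0 (λ b → ¬ab (a , b)))) (zeroʳ _)
    both (no _)  b? ¬ab = zeroˡ _

  gram-action : ∀ (f : Fin v → Carrier) a →
    sum (λ j → [ a J? j ] * sum (λ b → [ b J? j ] * f b)) + f a ≈ (k · 1#) * f a + sum f
  gram-action f a = begin
    sum (λ j → [ a J? j ] * sum (λ b → [ b J? j ] * f b)) + f a
      ≈⟨ +-cong (sum-*-assoc _ (λ j b → [ b J? j ]) f) (sym (sum-δ a f)) ⟩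
    sum (λ b → M b * f b) + sum (λ b → [ a ≟ᶠ b ] * f b)
      ≈⟨ ∑-distrib-+ _ (λ b → [ a ≟ᶠ b ] * f b) ⟨
    sum (λ b → M b * f b + [ a ≟ᶠ b ] * f b)
      ≈⟨ sum-cong-≋ (λ b → begin
           M b * f b + [ a ≟ᶠ b ] * f b             ≈⟨ distribʳ _ _ _ ⟨
           (M b + [ a ≟ᶠ b ]) * f b                 ≈⟨ *-congʳ (gram a b) ⟩
           (1# + (k · 1#) * [ a ≟ᶠ b ]) * f b       ≈⟨ distribʳ _ _ _ ⟩
           1# * f b + (k · 1#) * [ a ≟ᶠ b ] * f b   ≈⟨ +-cong (*-identityˡ _) (*-assoc _ _ _) ⟩
           f b + (k · 1#) * ([ a ≟ᶠ b ] * f b)      ∎) ⟩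
    sum (λ b → f b + (k · 1#) * ([ a ≟ᶠ b ] * f b))
      ≈⟨ ∑-distrib-+ f _ ⟩
    sum f + sum (λ b → (k · 1#) * ([ a ≟ᶠ b ] * f b))
      ≈⟨ +-congˡ (trans (sym (*-distribˡ-sum (k · 1#) (λ b → [ a ≟ᶠ b ] * f b))) (*-congˡ (sum-δ a f))) ⟩
    sum f + (k · 1#) * f a
      ≈⟨ +-comm _ _ ⟩
    (k · 1#) * f a + sum f ∎
    where
    M : Fin v → Carrier
    M b = sum (λ j → [ a J? j ] * [ b J? j ])

-- Duality by counting: any two lines meet

module _ where
  open Sums ℕₚ.+-*-commutativeSemiring

  ·1≡id : ∀ n → n · 1 ≡ n
  ·1≡id zero    = ≡.refl
  ·1≡id (suc n) = ≡.cong suc (·1≡id n)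

  sum-mono : ∀ {n} {f g : Fin n → ℕ} → (∀ i → f i ℕ.≤ g i) → sum f ℕ.≤ sum g
  sum-mono {zero}  f≤g = z≤n
  sum-mono {suc n} f≤g = ℕₚ.+-mono-≤ (f≤g zero) (sum-mono (f≤g ∘ suc))

  -- A strict inequality in one term would make the sums differ strictly. This is what turns the
  -- count below into the existence of a common point.
  sum-≤-≡ : ∀ {n} {f g : Fin n → ℕ} → (∀ i → f i ℕ.≤ g i) → sum g ℕ.≤ sum f → ∀ i → g i ℕ.≤ f i
  sum-≤-≡ {suc n} {f} {g} f≤g Σg≤Σf zero =
    ℕₚ.+-cancelʳ-≤ (sum (g ∘ suc)) _ _ (ℕₚ.≤-trans Σg≤Σf (ℕₚ.+-monoʳ-≤ (f zero) (sum-mono (f≤g ∘ suc))))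
  sum-≤-≡ {suc n} {f} {g} f≤g Σg≤Σf (suc i) =
    sum-≤-≡ (f≤g ∘ suc)
      (ℕₚ.+-cancelˡ-≤ (g zero) _ _ (ℕₚ.≤-trans Σg≤Σf (ℕₚ.+-monoˡ-≤ _ (f≤g zero)))) i

  module _ {k v : ℕ} {_J_ : REL (Fin v) (Fin v) 0ℓ} (𝒟 : SquareDesign k v _J_) (v+k≡1+k² : v ℕ.+ k ≡ 1 ℕ.+ k ℕ.* k) where
    open SquareDesign 𝒟
    open Gram ℕₚ.+-*-commutativeSemiring 𝒟

    -- The k² incident pairs (a, j) with a J ℓ spread over the columns j; column ℓ takes k of
    -- them and each of the other v - 1 = k² - k columns at most one, hence exactly one.
    dual : SquareDesign k v (λ j a → a J j)
    dual = record
      { _J?_        = λ j a → a J? j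
      ; row-size    = column-size
      ; column-size = row-size
      ; unique-meet = λ {ℓ} {m} ℓ≢m → let a , aJℓ , aJm = common ℓ m ℓ≢m in
                      a , (aJℓ , aJm) , λ {b} (bJℓ , bJm) → unique ℓ≢m aJℓ aJm bJℓ bJm
      }
      where
      -- If a ≠ b, then ℓ and m would both be the single column meeting a and b.
      unique : ∀ {ℓ m a b} → ℓ ≢ m → a J ℓ → a J m → b J ℓ → b J m → a ≡ b
      unique {ℓ} {m} {a} {b} ℓ≢m aJℓ aJm bJℓ bJm with a ≟ᶠ b
      ... | yes a≡b = a≡b
      ... | no  a≢b = let _ , _ , u = unique-meet a≢b in
        contradiction (≡.trans (≡.sym (u (aJℓ , bJℓ))) (u (aJm , bJm))) ℓ≢m

      meets : Fin v → Fin v → ℕ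
      meets ℓ m = sum (λ a → [ a J? ℓ ] ℕ.* [ a J? m ])

      []*[] : ∀ {A B : Set} (a? : Dec A) (b? : Dec B) → [ a? ] ℕ.* [ b? ] ≡ [ a? ×-dec b? ]
      []*[] (yes _) b? = ℕₚ.+-identityʳ _
      []*[] (no _)  b? = ≡.refl

      []≤1 : ∀ {A : Set} (a? : Dec A) → [ a? ] ℕ.≤ 1
      []≤1 (yes _) = s≤s z≤n
      []≤1 (no _)  = z≤n

      common? : ∀ ℓ m → Dec (∃[ a ] (a J ℓ × a J m))
      common? ℓ m = any? (λ a → a J? ℓ ×-dec a J? m)

      meets≤1 : ∀ {ℓ m} → ℓ ≢ m → meets ℓ m ℕ.≤ 1
      meets≤1 {ℓ} {m} ℓ≢m with common? ℓ m
      ... | yes (a , aJℓ , aJm) = ℕₚ.≤-trans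
        (ℕₚ.≤-reflexive (≡.trans (sum-cong-≗ (λ b → []*[] (b J? ℓ) (b J? m))) (sum-single _ a λ b b≢a →
          [ b J? ℓ ×-dec b J? m ]≈0 λ (bJℓ , bJm) → b≢a (unique ℓ≢m bJℓ bJm aJℓ aJm))))
        ([]≤1 (a J? ℓ ×-dec a J? m))
      ... | no none = ℕₚ.≤-trans (ℕₚ.≤-reflexive (sum-0 λ b →
          ≡.trans ([]*[] (b J? ℓ) (b J? m)) ([ b J? ℓ ×-dec b J? m ]≈0 λ both → none (b , both)))) z≤n

      -- The right side is 1 off the column ℓ and 1 + k on it. The indicator on the left stands in
      -- for the subtraction in 1 + (k - 1), and equality holds at m = ℓ.
      bound : ∀ ℓ m → meets ℓ m ℕ.+ [ ℓ ≟ᶠ m ] ℕ.≤ 1 ℕ.+ [ ℓ ≟ᶠ m ] ℕ.* k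
      bound ℓ m with ℓ ≟ᶠ m
      ... | no  ℓ≢m = ℕₚ.≤-trans (ℕₚ.≤-reflexive (ℕₚ.+-identityʳ _)) (meets≤1 ℓ≢m)
      ... | yes ≡.refl = ℕₚ.≤-reflexive (≡.trans (ℕₚ.+-comm _ 1) (≡.cong suc (≡.trans
              (≡.trans (sum-cong-≗ idem) (≡.trans (column-sum ℓ) (·1≡id k)))
              (≡.sym (ℕₚ.+-identityʳ k)))))
        where
        idem : ∀ a → [ a J? ℓ ] ℕ.* [ a J? ℓ ] ≡ [ a J? ℓ ]
        idem a with a J? ℓ
        ... | yes _ = ≡.refl
        ... | no _  = ≡.refl

      -- Double counting: k rows meet ℓ, and each of them meets k columns.
      sum-meets : ∀ ℓ → sum (meets ℓ) ≡ k ℕ.* k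
      sum-meets ℓ = begin
        sum (meets ℓ)                                             ≡⟨ sum-cong-≗ (λ m → ≡.sym (ℕₚ.*-identityʳ (meets ℓ m))) ⟩
        sum (λ m → meets ℓ m ℕ.* 1)                               ≡⟨ sum-*-assoc (λ a → [ a J? ℓ ]) (λ a m → [ a J? m ]) (λ _ → 1) ⟨
        sum (λ a → [ a J? ℓ ] ℕ.* sum (λ m → [ a J? m ] ℕ.* 1))   ≡⟨ sum-cong-≗ (λ a → ≡.cong ([ a J? ℓ ] ℕ.*_)
                                                                       (≡.trans (sum-cong-≗ (λ m → ℕₚ.*-identityʳ [ a J? m ]))
                                                                          (≡.trans (row-sum a) (·1≡id k)))) ⟩
        sum (λ a → [ a J? ℓ ] ℕ.* k)                              ≡⟨ *-distribʳ-sum k (λ a → [ a J? ℓ ]) ⟨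
        sum (λ a → [ a J? ℓ ]) ℕ.* k                              ≡⟨ ≡.cong (ℕ._* k) (≡.trans (column-sum ℓ) (·1≡id k)) ⟩
        k ℕ.* k                                                   ∎
        where open ≡.≡-Reasoning

      total : ∀ ℓ → sum (λ m → 1 ℕ.+ [ ℓ ≟ᶠ m ] ℕ.* k) ≡ sum (λ m → meets ℓ m ℕ.+ [ ℓ ≟ᶠ m ])
      total ℓ = begin
        sum (λ m → 1 ℕ.+ [ ℓ ≟ᶠ m ] ℕ.* k)                 ≡⟨ ∑-distrib-+ {v} (λ _ → 1) _ ⟩
        sum {v} (λ _ → 1) ℕ.+ sum (λ m → [ ℓ ≟ᶠ m ] ℕ.* k) ≡⟨ ≡.cong₂ ℕ._+_ (≡.trans (sum-replicate v) (·1≡id v)) (sum-δ ℓ (λ _ → k)) ⟩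
        v ℕ.+ k                                            ≡⟨ v+k≡1+k² ⟩
        1 ℕ.+ k ℕ.* k                                      ≡⟨ ℕₚ.+-comm 1 _ ⟩
        k ℕ.* k ℕ.+ 1                                      ≡⟨ ≡.cong₂ ℕ._+_ (sum-meets ℓ) (sum-δ ℓ (λ _ → 1)) ⟨
        sum (meets ℓ) ℕ.+ sum (λ m → [ ℓ ≟ᶠ m ] ℕ.* 1)     ≡⟨ ≡.cong (sum (meets ℓ) ℕ.+_) (sum-cong-≗ (λ m → ℕₚ.*-identityʳ [ ℓ ≟ᶠ m ])) ⟩
        sum (meets ℓ) ℕ.+ sum (λ m → [ ℓ ≟ᶠ m ])           ≡⟨ ∑-distrib-+ (meets ℓ) _ ⟨
        sum (λ m → meets ℓ m ℕ.+ [ ℓ ≟ᶠ m ])               ∎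
        where open ≡.≡-Reasoning

      common : ∀ ℓ m → ℓ ≢ m → ∃[ a ] (a J ℓ × a J m)
      common ℓ m ℓ≢m with common? ℓ m
      ... | yes c = c
      -- By `total` the two sides of `bound` have the same sum, so every term attains its bound;
      -- without a common row the left side at m would be 0.
      ... | no none = contradiction
        (≡.subst (1 ℕ.≤_) meets≡0 (ℕₚ.≤-trans (ℕₚ.m≤m+n 1 _)
          (sum-≤-≡ (bound ℓ) (ℕₚ.≤-reflexive (total ℓ)) m)))
        λ ()
        where
        meets≡0 : meets ℓ m ℕ.+ [ ℓ ≟ᶠ m ] ≡ 0
        meets≡0 = ≡.cong₂ ℕ._+_
          (sum-0 λ a → ≡.trans ([]*[] (a J? ℓ) (a J? m)) ([ a J? ℓ ×-dec a J? m ]≈0 λ both → none (a , both)))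
          ([ ℓ ≟ᶠ m ]≈0 ℓ≢m)

-- The eigenvalue equations over a commutative ring

module PlaneAlgebra (R : CommutativeRing 0ℓ 0ℓ) {k v : ℕ} {_J_ : REL (Fin v) (Fin v) 0ℓ}
  (𝒟 : SquareDesign k v _J_) (v+k≡1+k² : v ℕ.+ k ≡ 1 ℕ.+ k ℕ.* k) (lam : ℕ) where

  open CommutativeRing R hiding (zero)
  open IntegerCoefficients R
  open Sums commutativeSemiring
  open SquareDesign 𝒟
  open Gram commutativeSemiring 𝒟
  open SetoidReasoning setoid
  private module Dual = Gram commutativeSemiring (dual 𝒟 v+k≡1+k²)

  κ Λ ν D : Carrier
  κ = k · 1#
  Λ = lam · 1#
  ν = v · 1#
  D = κ + Λ - 1#

  ∑ˡ ∑ᵖ : (Fin v → Carrier) → Fin v → Carrier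
  ∑ˡ h p = sum (λ ℓ → [ p J? ℓ ] * h ℓ)
  ∑ᵖ f ℓ = sum (λ p → [ p J? ℓ ] * f p)

  copies : (Fin v → Fin lam → Carrier) → Fin v → Carrier
  copies g ℓ = sum (g ℓ)

  -- Linearity of N for a relation that cannot be solved for h, since a need not be invertible.
  ∑ˡ-scale : ∀ {a b h h′} → (∀ ℓ → a * h ℓ ≈ b * h′ ℓ) → ∀ p → a * ∑ˡ h p ≈ b * ∑ˡ h′ p
  ∑ˡ-scale {a} {b} {h} {h′} ah≈bh′ p = begin
    a * ∑ˡ h p                            ≈⟨ *-distribˡ-sum a (λ ℓ → [ p J? ℓ ] * h ℓ) ⟩
    sum (λ ℓ → a * ([ p J? ℓ ] * h ℓ))    ≈⟨ sum-cong-≋ (λ ℓ → exchange a [ p J? ℓ ] (h ℓ)) ⟩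
    sum (λ ℓ → [ p J? ℓ ] * (a * h ℓ))    ≈⟨ sum-cong-≋ (λ ℓ → *-congˡ (ah≈bh′ ℓ)) ⟩
    sum (λ ℓ → [ p J? ℓ ] * (b * h′ ℓ))   ≈⟨ sum-cong-≋ (λ ℓ → exchange b [ p J? ℓ ] (h′ ℓ)) ⟨
    sum (λ ℓ → b * ([ p J? ℓ ] * h′ ℓ))   ≈⟨ *-distribˡ-sum b (λ ℓ → [ p J? ℓ ] * h′ ℓ) ⟨
    b * ∑ˡ h′ p                           ∎
    where
    exchange : ∀ x y z → x * (y * z) ≈ y * (x * z)
    exchange = solve 3 (λ x y z → x :* (y :* z) := y :* (x :* z)) refl

  ∑ˡ-const : ∀ x p → ∑ˡ (λ _ → x) p ≈ κ * x
  ∑ˡ-const x p = trans (sym (*-distribʳ-sum x (λ ℓ → [ p J? ℓ ]))) (*-congʳ (row-sum p))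

  ∑ᵖ-const : ∀ x ℓ → ∑ᵖ (λ _ → x) ℓ ≈ κ * x
  ∑ᵖ-const x ℓ = trans (sym (*-distribʳ-sum x (λ p → [ p J? ℓ ]))) (*-congʳ (column-sum ℓ))

  ∑ˡ-0 : ∀ {h} → (∀ ℓ → h ℓ ≈ 0#) → ∀ p → ∑ˡ h p ≈ 0#
  ∑ˡ-0 h≈0 p = sum-0 λ ℓ → trans (*-congˡ (h≈0 ℓ)) (zeroʳ _)

  ∑ᵖ-0 : ∀ {f} → (∀ p → f p ≈ 0#) → ∀ ℓ → ∑ᵖ f ℓ ≈ 0#
  ∑ᵖ-0 f≈0 ℓ = sum-0 λ p → trans (*-congˡ (f≈0 p)) (zeroʳ _)

  sum-∑ˡ : ∀ h → sum (∑ˡ h) ≈ κ * sum h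
  sum-∑ˡ h = begin
    sum (∑ˡ h)                                  ≈⟨ ∑-comm (λ p ℓ → [ p J? ℓ ] * h ℓ) ⟩
    sum (λ ℓ → sum (λ p → [ p J? ℓ ] * h ℓ))    ≈⟨ sum-cong-≋ (λ ℓ → *-distribʳ-sum (h ℓ) (λ p → [ p J? ℓ ])) ⟨
    sum (λ ℓ → sum (λ p → [ p J? ℓ ]) * h ℓ)    ≈⟨ sum-cong-≋ (λ ℓ → *-congʳ (column-sum ℓ)) ⟩
    sum (λ ℓ → κ * h ℓ)                         ≈⟨ *-distribˡ-sum κ h ⟨
    κ * sum h                                   ∎

  -- With D = k + λ - 1, the degrees are k D for points and D for blocks; ρ, β and σ stand
  -- for 1/(k D), 1/D and √(1/(k D²)), the absolute values of the off-diagonal entries.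
  module Operator (ρ β σ : Carrier) where

    -- The normalized Laplacian at a point and at a block, for a vector with entries f on
    -- the points and g on the blocks.
    ℒᵖ : (Fin v → Carrier) → (Fin v → Fin lam → Carrier) → Fin v → Carrier
    ℒᵖ f g p = f p - (ρ * (sum f - f p) + σ * ∑ˡ (copies g) p)

    ℒᵇ : (Fin v → Carrier) → (Fin v → Fin lam → Carrier) → Fin v → Fin lam → Carrier
    ℒᵇ f g ℓ i = g ℓ i - (σ * ∑ᵖ f ℓ + β * (copies g ℓ - g ℓ i))

    Eigen : Carrier → (Fin v → Carrier) → (Fin v → Fin lam → Carrier) → Set
    Eigen θ f g = (∀ p → ℒᵖ f g p ≈ θ * f p) × (∀ ℓ i → ℒᵇ f g ℓ i ≈ θ * g ℓ i)

  module Spectrum (ρ β σ c : Carrier)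
    (κρ≈β : κ * ρ ≈ β) (Dβ≈1 : D * β ≈ 1#) (σσ≈ρβ : σ * σ ≈ ρ * β) (c[κ-1]≈1 : c * (κ - 1#) ≈ 1#) where

    open Operator ρ β σ

    -- When σ is the positive root of 1/(k D²), ω is √k; written through σ, it requires no second
    -- root.
    ω θ₁ θ₂ : Carrier
    ω  = σ * (κ * D)
    θ₁ = ν * ρ
    θ₂ = 1# + β

    ν+κ≈1+κκ : ν + κ ≈ 1# + κ * κ
    ν+κ≈1+κκ = begin
      v · 1# + k · 1#       ≈⟨ ×-homo-+ 1# v k ⟨
      (v ℕ.+ k) · 1#        ≡⟨ ≡.cong (_· 1#) v+k≡1+k² ⟩
      1# + (k ℕ.* k) · 1#   ≈⟨ +-congˡ (×1-homo-* k k) ⟩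
      1# + κ * κ            ∎

    Λβ≈ : Λ * β ≈ 1# - κ * β + β
    Λβ≈ = by-combination
      (solve 3 (λ κ Λ β → Λ :* β := (1′ :- κ :* β :+ β) :+ 1′ :* ((κ :+ Λ :- 1′) :* β :- 1′)) refl κ Λ β)
      (1# ⊛ Dβ≈1)

    -- Here v = k² - k + 1 enters: v ρ becomes (k - 1) β + ρ, the form in which the Gram matrix
    -- produces this eigenvalue.
    θ₁≈ : θ₁ ≈ κ * β - β + ρ
    θ₁≈ = by-combination
      (solve 4 (λ κ ν ρ β → ν :* ρ := (κ :* β :- β :+ ρ) :+
          (ρ :* (ν :+ κ :- (1′ :+ κ :* κ)) :+ (κ :- 1′) :* (κ :* ρ :- β))) refl κ ν ρ β)
      (ρ ⊛ ν+κ≈1+κκ ⊞ (κ - 1#) ⊛ κρ≈β)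

    ωσ≈β : ω * σ ≈ β
    ωσ≈β = by-combination
      (solve 5 (λ κ D ρ β σ → σ :* (κ :* D) :* σ := β :+
          (κ :* D :* (σ :* σ :- ρ :* β) :+ D :* β :* (κ :* ρ :- β) :+ β :* (D :* β :- 1′))) refl κ D ρ β σ)
      ((κ * D) ⊛ σσ≈ρβ ⊞ (D * β) ⊛ κρ≈β ⊞ β ⊛ Dβ≈1)

    ρω≈σ : ρ * ω ≈ σ
    ρω≈σ = by-combination
      (solve 5 (λ κ D ρ β σ → ρ :* (σ :* (κ :* D)) := σ :+
          (σ :* D :* (κ :* ρ :- β) :+ σ :* (D :* β :- 1′))) refl κ D ρ β σ)
      ((σ * D) ⊛ κρ≈β ⊞ σ ⊛ Dβ≈1)

    βω≈κσ : β * ω ≈ κ * σ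
    βω≈κσ = by-combination
      (solve 4 (λ κ D β σ → β :* (σ :* (κ :* D)) := κ :* σ :+ κ :* σ :* (D :* β :- 1′)) refl κ D β σ)
      ((κ * σ) ⊛ Dβ≈1)

    ρDκ≈1 : ρ * D * κ ≈ 1#
    ρDκ≈1 = by-combination
      (solve 4 (λ κ D ρ β → ρ :* D :* κ := 1′ :+ (D :* (κ :* ρ :- β) :+ 1′ :* (D :* β :- 1′))) refl κ D ρ β)
      (D ⊛ κρ≈β ⊞ 1# ⊛ Dβ≈1)

    Dωσ≈1 : D * ω * σ ≈ 1#
    Dωσ≈1 = trans (*-assoc D ω σ) (trans (*-congˡ ωσ≈β) Dβ≈1)

    -- The roots √(k D) and √D of the degrees, divided by √(k D): the value on the blocks is 1/√k =
    -- σ D.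
    eigen-0 : Eigen 0# (λ _ → 1#) (λ _ _ → σ * D)
    eigen-0 = at-point , λ ℓ _ → at-block ℓ
      where
      f : Fin v → Carrier
      f _ = 1#
      g : Fin v → Fin lam → Carrier
      g _ _ = σ * D

      at-point : ∀ p → ℒᵖ f g p ≈ 0# * 1#
      at-point p = by-combination
        (solve 9 (λ κ Λ ν D ρ β σ F t →
            1′ :- (ρ :* (F :- 1′) :+ σ :* t) := con (ℤ.+ 0) :* 1′ :+
            (:- ρ :* (F :- ν :* 1′) :+ :- σ :* (t :- κ :* (Λ :* (σ :* D))) :+ :- Λ :* (σ :* (κ :* D) :* σ :- β)
              :+ :- 1′ :* (ν :* ρ :- (κ :* β :- β :+ ρ)) :+ :- 1′ :* (Λ :* β :- (1′ :- κ :* β :+ β))))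
          refl κ Λ ν D ρ β σ (sum f) (∑ˡ (copies g) p))
        (- ρ ⊛ sum-const v 1#
         ⊞ - σ ⊛ trans (sum-cong-≋ (λ ℓ → *-congˡ {[ p J? ℓ ]} (sum-const lam (σ * D)))) (∑ˡ-const (Λ * (σ * D)) p)
         ⊞ - Λ ⊛ ωσ≈β ⊞ - 1# ⊛ θ₁≈ ⊞ - 1# ⊛ Λβ≈)

      at-block : ∀ ℓ → σ * D - (σ * ∑ᵖ f ℓ + β * (copies g ℓ - σ * D)) ≈ 0# * (σ * D)
      at-block ℓ = by-combination
        (solve 7 (λ κ Λ D β σ s G →
            σ :* D :- (σ :* s :+ β :* (G :- σ :* D)) := con (ℤ.+ 0) :* (σ :* D) :+
            (:- σ :* (s :- κ :* 1′) :+ :- β :* (G :- Λ :* (σ :* D))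
              :+ :- (σ :* D) :* (Λ :* β :- (1′ :- κ :* β :+ β)) :+ σ :* κ :* (D :* β :- 1′)))
          refl κ Λ D β σ (∑ᵖ f ℓ) (copies g ℓ))
        (- σ ⊛ ∑ᵖ-const 1# ℓ ⊞ - β ⊛ sum-const lam (σ * D) ⊞ - (σ * D) ⊛ Λβ≈ ⊞ (σ * κ) ⊛ Dβ≈1)

    -- For g constant on the copies of ℓ, the block equation reads (k β - θ₁) g = σ `∑ᵖ f ℓ`. Since
    -- k β - θ₁ = β - ρ = (k - 1) ρ and σ = ρ ω, this forces the factor c ω.
    eigen-θ₁ : ∀ f → sum f ≈ 0# → Eigen θ₁ f (λ ℓ _ → c * ω * ∑ᵖ f ℓ)
    eigen-θ₁ f ∑f≈0 = at-point , λ ℓ _ → at-block ℓ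
      where
      g : Fin v → Fin lam → Carrier
      g ℓ _ = c * ω * ∑ᵖ f ℓ

      ∑ˡ-copies : ∀ p → ∑ˡ (copies g) p ≈ Λ * (c * ω) * ∑ˡ (∑ᵖ f) p
      ∑ˡ-copies p = trans (sym (*-identityˡ _)) (∑ˡ-scale
        (λ ℓ → trans (*-identityˡ _) (trans (sum-const lam (c * ω * ∑ᵖ f ℓ)) (sym (*-assoc _ _ _)))) p)

      at-point : ∀ p → ℒᵖ f g p ≈ θ₁ * f p
      at-point p = by-combination
        (solve 12 (λ κ Λ ν ρ β σ c ω F t u x →
            x :- (ρ :* (F :- x) :+ σ :* t) := ν :* ρ :* x :+
            (:- σ :* (t :- Λ :* (c :* ω) :* u)
              :+ :- (σ :* (Λ :* (c :* ω))) :* ((u :+ x) :- (κ :* x :+ F))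
              :+ (:- ρ :- σ :* (Λ :* (c :* ω))) :* (F :- con (ℤ.+ 0))
              :+ :- (σ :* Λ :* ω :* x) :* (c :* (κ :- 1′) :- 1′)
              :+ :- (Λ :* x) :* (ω :* σ :- β)
              :+ :- x :* (ν :* ρ :- (κ :* β :- β :+ ρ)) :+ :- x :* (Λ :* β :- (1′ :- κ :* β :+ β))))
          refl κ Λ ν ρ β σ c ω (sum f) (∑ˡ (copies g) p) (∑ˡ (∑ᵖ f) p) (f p))
        (- σ ⊛ ∑ˡ-copies p
         ⊞ - (σ * (Λ * (c * ω))) ⊛ gram-action f p
         ⊞ (- ρ - σ * (Λ * (c * ω))) ⊛ ∑f≈0
         ⊞ - (σ * Λ * ω * f p) ⊛ c[κ-1]≈1
         ⊞ - (Λ * f p) ⊛ ωσ≈β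
         ⊞ - f p ⊛ θ₁≈ ⊞ - f p ⊛ Λβ≈)

      at-block : ∀ ℓ → c * ω * ∑ᵖ f ℓ - (σ * ∑ᵖ f ℓ + β * (copies g ℓ - c * ω * ∑ᵖ f ℓ)) ≈ θ₁ * (c * ω * ∑ᵖ f ℓ)
      at-block ℓ = by-combination
        (solve 10 (λ κ Λ ν ρ β σ c ω G s →
            c :* ω :* s :- (σ :* s :+ β :* (G :- c :* ω :* s)) := ν :* ρ :* (c :* ω :* s) :+
            (:- β :* (G :- Λ :* (c :* ω :* s))
              :+ :- (c :* ω :* s) :* (Λ :* β :- (1′ :- κ :* β :+ β))
              :+ :- (c :* ω :* s) :* (ν :* ρ :- (κ :* β :- β :+ ρ))
              :+ c :* s :* (β :* ω :- κ :* σ) :+ :- (c :* s) :* (ρ :* ω :- σ)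
              :+ σ :* s :* (c :* (κ :- 1′) :- 1′)))
          refl κ Λ ν ρ β σ c ω (copies g ℓ) (∑ᵖ f ℓ))
        (- β ⊛ sum-const lam (c * ω * ∑ᵖ f ℓ)
         ⊞ - (c * ω * ∑ᵖ f ℓ) ⊛ Λβ≈ ⊞ - (c * ω * ∑ᵖ f ℓ) ⊛ θ₁≈
         ⊞ (c * ∑ᵖ f ℓ) ⊛ βω≈κσ ⊞ - (c * ∑ᵖ f ℓ) ⊛ ρω≈σ ⊞ (σ * ∑ᵖ f ℓ) ⊛ c[κ-1]≈1)

    -- The other copies in the clique of a block sum to minus its own value, which contributes the
    -- additional β; everything else vanishes.
    eigen-θ₂ : ∀ g → (∀ ℓ → copies g ℓ ≈ 0#) → Eigen θ₂ (λ _ → 0#) g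
    eigen-θ₂ g copies≈0 =
      (λ p → by-combination
        (solve 5 (λ ρ β σ F t →
            con (ℤ.+ 0) :- (ρ :* (F :- con (ℤ.+ 0)) :+ σ :* t) := (1′ :+ β) :* con (ℤ.+ 0) :+
            (:- ρ :* (F :- con (ℤ.+ 0)) :+ :- σ :* (t :- con (ℤ.+ 0))))
          refl ρ β σ (sum {v} (λ _ → 0#)) (∑ˡ (copies g) p))
        (- ρ ⊛ sum-0 {v} (λ _ → refl) ⊞ - σ ⊛ ∑ˡ-0 copies≈0 p))
      , λ ℓ i → by-combination
        (solve 5 (λ β σ s G y →
            y :- (σ :* s :+ β :* (G :- y)) := (1′ :+ β) :* y :+
            (:- σ :* (s :- con (ℤ.+ 0)) :+ :- β :* (G :- con (ℤ.+ 0))))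
          refl β σ (∑ᵖ (λ _ → 0#) ℓ) (copies g ℓ) (g ℓ i))
        (- σ ⊛ ∑ᵖ-0 (λ _ → refl) ℓ ⊞ - β ⊛ copies≈0 ℓ)

    -- The form in which "θ is not this value" is used. Over ℝ it follows from the mere negation of
    -- equality, whereas an inverse would need a positive lower bound on the difference.
    Cancellable : Carrier → Set
    Cancellable x = ∀ y → x * y ≈ 0# → y ≈ 0#

    module _ {θ f g} (eigen : Eigen θ f g)
      (cancel-θ : Cancellable θ) (cancel-θ₁ : Cancellable (θ - θ₁)) (cancel-θ₂ : Cancellable (θ - θ₂)) where

      private
        F = sum f
        G = copies g

      -- Sum the block equation over the copies of ℓ and use 1 + β - Λ β = κ β. The equation is not
      -- solved for `G ℓ`, because θ may equal κ β.
      copies-eq : ∀ ℓ → (κ * β - θ) * G ℓ ≈ Λ * σ * ∑ᵖ f ℓ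
      copies-eq ℓ = by-combination
        (solve 7 (λ κ Λ β σ θ s G →
            (κ :* β :- θ) :* G := Λ :* σ :* s :+
            (1′ :* (G :* (1′ :+ β :- θ) :- Λ :* (σ :* s :+ β :* G)) :+ G :* (Λ :* β :- (1′ :- κ :* β :+ β))))
          refl κ Λ β σ θ (∑ᵖ f ℓ) (G ℓ))
        (1# ⊛ summed ⊞ G ℓ ⊛ Λβ≈)
        where
        each : ∀ i → g ℓ i * (1# + β - θ) ≈ σ * ∑ᵖ f ℓ + β * G ℓ
        each i = by-combination
          (solve 6 (λ β σ θ s G y → y :* (1′ :+ β :- θ) := σ :* s :+ β :* G :+
              1′ :* ((y :- (σ :* s :+ β :* (G :- y))) :- θ :* y)) refl β σ θ (∑ᵖ f ℓ) (G ℓ) (g ℓ i))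
          (1# ⊛ proj₂ eigen ℓ i)
        summed : G ℓ * (1# + β - θ) ≈ Λ * (σ * ∑ᵖ f ℓ + β * G ℓ)
        summed = trans (*-distribʳ-sum (1# + β - θ) (g ℓ)) (trans (sum-cong-≋ each) (sum-const lam _))

      -- Multiply the point equation by κ β - θ, so that `copies-eq` and the Gram matrix remove the
      -- blocks. The coefficient of `f p` is then a quadratic in θ with roots θ₁ and θ₂, and that of
      -- F is ρ (θ - θ₂) because κ β + Λ β = 1 + β.
      point-eq : ∀ p → (θ - θ₂) * ((θ - θ₁) * f p + ρ * F) ≈ 0#
      point-eq p = by-combination
        (solve 11 (λ κ Λ ν ρ β σ θ F t u x →
            (θ :- (1′ :+ β)) :* ((θ :- ν :* ρ) :* x :+ ρ :* F) := con (ℤ.+ 0) :+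
            ((κ :* β :- θ) :* ((x :- (ρ :* (F :- x) :+ σ :* t)) :- θ :* x)
              :+ σ :* ((κ :* β :- θ) :* t :- Λ :* σ :* u)
              :+ Λ :* σ :* σ :* ((u :+ x) :- (κ :* x :+ F))
              :+ Λ :* (κ :* x :- x :+ F) :* (σ :* σ :- ρ :* β)
              :+ ρ :* (κ :* x :- x :+ F) :* (Λ :* β :- (1′ :- κ :* β :+ β))
              :+ (1′ :- κ :* β :+ β) :* x :* (κ :* ρ :- β)
              :+ :- ((θ :- (1′ :+ β)) :* x) :* (ν :* ρ :- (κ :* β :- β :+ ρ))))
          refl κ Λ ν ρ β σ θ F (∑ˡ G p) (∑ˡ (∑ᵖ f) p) (f p))
        ((κ * β - θ) ⊛ proj₁ eigen p
         ⊞ σ ⊛ ∑ˡ-scale copies-eq p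
         ⊞ (Λ * σ * σ) ⊛ gram-action f p
         ⊞ (Λ * (κ * f p - f p + F)) ⊛ σσ≈ρβ
         ⊞ (ρ * (κ * f p - f p + F)) ⊛ Λβ≈
         ⊞ ((1# - κ * β + β) * f p) ⊛ κρ≈β
         ⊞ (- ((θ - θ₂) * f p)) ⊛ θ₁≈)

      -- Summed over the v points, ρ F becomes θ₁ F and cancels the θ₁ in θ - θ₁.
      F≈0 : F ≈ 0#
      F≈0 = cancel-θ F (begin
        θ * F                                     ≈⟨ solve 4 (λ θ ν ρ F → θ :* F := (θ :- ν :* ρ) :* F :+ ν :* (ρ :* F)) refl θ ν ρ F ⟩
        (θ - θ₁) * F + ν * (ρ * F)                ≈⟨ +-cong (*-distribˡ-sum (θ - θ₁) f) (sym (sum-const v (ρ * F))) ⟩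
        sum (λ p → (θ - θ₁) * f p) + sum {v} (λ _ → ρ * F) ≈⟨ ∑-distrib-+ (λ p → (θ - θ₁) * f p) (λ _ → ρ * F) ⟨
        sum (λ p → (θ - θ₁) * f p + ρ * F)        ≈⟨ sum-0 (λ p → cancel-θ₂ _ (point-eq p)) ⟩
        0#                                        ∎)

      f≈0 : ∀ p → f p ≈ 0#
      f≈0 p = cancel-θ₁ (f p) (by-combination
        (solve 5 (λ θ ν ρ F x → (θ :- ν :* ρ) :* x := con (ℤ.+ 0) :+
            (1′ :* ((θ :- ν :* ρ) :* x :+ ρ :* F :- con (ℤ.+ 0)) :+ :- ρ :* (F :- con (ℤ.+ 0)))) refl θ ν ρ F (f p))
        (1# ⊛ cancel-θ₂ _ (point-eq p) ⊞ - ρ ⊛ F≈0))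

      -- For f = 0 the point equation leaves σ `∑ˡ G p` = 0, and D ω is inverse to σ. From
      -- `copies-eq` one would obtain only (κ β - θ) `G ℓ` = 0, which is inconclusive at θ = κ β.
      ∑ˡG≈0 : ∀ p → ∑ˡ G p ≈ 0#
      ∑ˡG≈0 p = by-combination
        (solve 8 (λ D ω ρ σ θ F t x → t := con (ℤ.+ 0) :+
            (:- (D :* ω) :* ((x :- (ρ :* (F :- x) :+ σ :* t)) :- θ :* x)
              :+ D :* ω :* (1′ :+ ρ :- θ) :* (x :- con (ℤ.+ 0))
              :+ :- (D :* ω :* ρ) :* (F :- con (ℤ.+ 0))
              :+ :- t :* (D :* ω :* σ :- 1′)))
          refl D ω ρ σ θ F (∑ˡ G p) (f p))
        (- (D * ω) ⊛ proj₁ eigen p ⊞ (D * ω * (1# + ρ - θ)) ⊛ f≈0 p ⊞ - (D * ω * ρ) ⊛ F≈0 ⊞ - ∑ˡ G p ⊛ Dωσ≈1)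

      ∑G≈0 : sum G ≈ 0#
      ∑G≈0 = by-combination
        (solve 4 (λ κ D ρ y → y := con (ℤ.+ 0) :+
            (ρ :* D :* (κ :* y :- con (ℤ.+ 0)) :+ :- y :* (ρ :* D :* κ :- 1′))) refl κ D ρ (sum G))
        ((ρ * D) ⊛ trans (sym (sum-∑ˡ G)) (sum-0 ∑ˡG≈0) ⊞ - sum G ⊛ ρDκ≈1)

      G≈0 : ∀ ℓ → G ℓ ≈ 0#
      G≈0 ℓ = by-combination
        (solve 5 (λ κ c s y z → y := con (ℤ.+ 0) :+
            (:- c :* ((s :+ y) :- (κ :* y :+ z)) :+ c :* (s :- con (ℤ.+ 0)) :+ :- c :* (z :- con (ℤ.+ 0))
              :+ :- y :* (c :* (κ :- 1′) :- 1′)))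
          refl κ c (∑ᵖ (∑ˡ G) ℓ) (G ℓ) (sum G))
        (- c ⊛ Dual.gram-action G ℓ ⊞ c ⊛ ∑ᵖ-0 ∑ˡG≈0 ℓ ⊞ - c ⊛ ∑G≈0 ⊞ - G ℓ ⊛ c[κ-1]≈1)

      g≈0 : ∀ ℓ i → g ℓ i ≈ 0#
      g≈0 ℓ i = cancel-θ₂ (g ℓ i) (by-combination
        (solve 6 (λ β σ θ s G y → (θ :- (1′ :+ β)) :* y := con (ℤ.+ 0) :+
            (:- 1′ :* ((y :- (σ :* s :+ β :* (G :- y))) :- θ :* y)
              :+ :- σ :* (s :- con (ℤ.+ 0)) :+ :- β :* (G :- con (ℤ.+ 0))))
          refl β σ θ (∑ᵖ f ℓ) (G ℓ) (g ℓ i))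
        (- 1# ⊛ proj₂ eigen ℓ i ⊞ - σ ⊛ ∑ᵖ-0 f≈0 ℓ ⊞ - β ⊛ G≈0 ℓ))

-- The Laplacian of a graph as an operator

module Laplacian (R : CommutativeRing 0ℓ 0ℓ) (G : Graph)
  (W : Graph.Vertex G → Graph.Vertex G → CommutativeRing.Carrier R) where
  open CommutativeRing R hiding (zero)
  open Graph G using (Vertex; degree; _~?_; _≟ᵛ_)

  -- `ℒ` with an arbitrary weight in place of the square root, so that it makes sense over any
  -- commutative ring.
  laplacian : Vertex → Vertex → Carrier
  laplacian u w =
    if does (u ≟ᵛ w) then
      (if does (degree u ℕₚ.≟ 0) then 0# else 1#)
    else if does (u ~? w) then - W u w
    else 0#

-- M is the Laplacian, but a variable here: over ℝ, deciding whether two types mentioning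
-- unfolded entries are equal would require comparing Cauchy proofs.
module LaplacianAction (R : CommutativeRing 0ℓ 0ℓ) (G : Graph)
  (W M : Graph.Vertex G → Graph.Vertex G → CommutativeRing.Carrier R)
  (M≡laplacian : ∀ u w → M u w ≡ Laplacian.laplacian R G W u w) where
  open CommutativeRing R hiding (zero)
  open IntegerCoefficients R
  open Sums commutativeSemiring
  open Graph G using (Vertex; vertices; vertex; degree; _~_; _~?_; _≟ᵛ_; ~-irrefl)
  open SetoidReasoning setoid

  -- Irreflexivity keeps the two indicators from overlapping, and the nonzero degree makes the
  -- diagonal entry 1.
  entry≈ : ∀ {u} → degree u ≢ 0 → ∀ w → M u w ≈ [ u ≟ᵛ w ] - [ u ~? w ] * W u w
  entry≈ {u} d≢0 w = trans (reflexive (M≡laplacian u w)) (entry (u ≟ᵛ w) (u ~? w))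
    where
    entry : (e : Dec (u ≡ w)) (a : Dec (u ~ w)) →
      (if does e then (if does (degree u ℕₚ.≟ 0) then 0# else 1#) else if does a then - W u w else 0#)
        ≈ [ e ] - [ a ] * W u w
    entry (yes ≡.refl) (yes u~u) = contradiction u~u (~-irrefl ≡.refl)
    entry (yes ≡.refl) (no _)    = trans
      (reflexive (≡.cong (if_then 0# else 1#) (dec-false (degree u ℕₚ.≟ 0) d≢0)))
      (solve 1 (λ x → 1′ := 1′ :- con (ℤ.+ 0) :* x) refl (W u u))
    entry (no _)       (yes _)   = solve 1 (λ x → :- x := con (ℤ.+ 0) :- 1′ :* x) refl (W u w)
    entry (no _)       (no _)    = solve 1 (λ x → con (ℤ.+ 0) := con (ℤ.+ 0) :- con (ℤ.+ 0) :* x) refl (W u w)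

  ∑-δ : ∀ u (x : Vertex → Carrier) → sum (λ i → [ u ≟ᵛ vertex i ] * x (vertex i)) ≈ x u
  ∑-δ u x = begin
    sum (λ i → [ u ≟ᵛ vertex i ] * x (vertex i)) ≈⟨ sum-single _ (Inverse.from vertices u) (λ i i≢ →
                                                      trans (*-congʳ ([ u ≟ᵛ vertex i ]≈0 λ u≡ → i≢ (≡.trans
                                                        (≡.sym (Inverse.strictlyInverseʳ vertices i))
                                                        (≡.cong (Inverse.from vertices) (≡.sym u≡))))) (zeroˡ _)) ⟩
    [ u ≟ᵛ u′ ] * x u′                           ≈⟨ trans (*-congʳ ([ u ≟ᵛ u′ ]≈1 (≡.sym u′≡u))) (*-identityˡ _) ⟩
    x u′                                         ≡⟨ ≡.cong x u′≡u ⟩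
    x u                                          ∎
    where
    u′ = vertex (Inverse.from vertices u)
    u′≡u = Inverse.strictlyInverseˡ vertices u

  laplacian-action : ∀ {u} → degree u ≢ 0 → ∀ x →
    sum (λ i → M u (vertex i) * x (vertex i))
      ≈ x u - sum (λ i → [ u ~? vertex i ] * (W u (vertex i) * x (vertex i)))
  laplacian-action {u} d≢0 x = begin
    sum (λ i → M u (vertex i) * x (vertex i))
      ≈⟨ sum-cong-≋ (λ i → trans (*-congʳ (entry≈ d≢0 (vertex i)))
           (solve 4 (λ e a w x → (e :- a :* w) :* x := e :* x :+ :- 1′ :* (a :* (w :* x))) refl
             [ u ≟ᵛ vertex i ] [ u ~? vertex i ] (W u (vertex i)) (x (vertex i)))) ⟩
    sum (λ i → [ u ≟ᵛ vertex i ] * x (vertex i) + - 1# * ([ u ~? vertex i ] * (W u (vertex i) * x (vertex i))))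
      ≈⟨ ∑-distrib-+ (λ i → [ u ≟ᵛ vertex i ] * x (vertex i)) _ ⟩
    sum (λ i → [ u ≟ᵛ vertex i ] * x (vertex i)) + sum (λ i → - 1# * ([ u ~? vertex i ] * (W u (vertex i) * x (vertex i))))
      ≈⟨ +-cong (∑-δ u x) (trans (sym (*-distribˡ-sum (- 1#) (λ i → [ u ~? vertex i ] * (W u (vertex i) * x (vertex i))))) (-1*x≈-x _)) ⟩
    x u - sum (λ i → [ u ~? vertex i ] * (W u (vertex i) * x (vertex i))) ∎
    where open import Algebra.Properties.Ring ring using (-1*x≈-x)

-- Neighbourhoods and degrees in `Γ`

module Plane {k v : ℕ} (Π : ProjectivePlane k v) where
  open ProjectivePlane Π

  k≤k² : k ℕ.≤ k ℕ.* k
  k≤k² = ℕₚ.m≤m*n k k {{ℕ.>-nonZero (ℕₚ.≤-trans (ℕ.s≤s ℕ.z≤n) 2≤k)}}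

  v+k≡1+k² : v ℕ.+ k ≡ 1 ℕ.+ k ℕ.* k
  v+k≡1+k² = begin
    v ℕ.+ k                       ≡⟨ ≡.cong (ℕ._+ k) v≡k²-k+1 ⟩
    k ℕ.* k ℕ.∸ k ℕ.+ 1 ℕ.+ k     ≡⟨ ℕₚ.+-assoc _ 1 k ⟩
    k ℕ.* k ℕ.∸ k ℕ.+ (1 ℕ.+ k)   ≡⟨ ℕₚ.+-suc _ k ⟩
    suc (k ℕ.* k ℕ.∸ k ℕ.+ k)     ≡⟨ ≡.cong suc (ℕₚ.m∸n+n≡m k≤k²) ⟩
    1 ℕ.+ k ℕ.* k                 ∎
    where open ≡.≡-Reasoning

  design : SquareDesign k v _I_
  design = record
    { _J?_        = _I?_
    ; row-size    = point-size
    ; column-size = line-size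
    ; unique-meet = unique-line
    }

module Neighbourhoods (S : CommutativeSemiring 0ℓ 0ℓ) {k v : ℕ} (Π : ProjectivePlane k v) (lam : ℕ) where
  open CommutativeSemiring S hiding (zero)
  open Sums S
  open ProjectivePlane Π
  open RepeatedLines Π lam
  open Graph Γ using (Vertex; vertex)
  open SetoidReasoning setoid

  sum-vertices : ∀ (x : Vertex → Carrier) →
    sum (λ i → x (vertex i)) ≈ sum (λ p → x (inj₁ p)) + sum (λ ℓ → sum (λ i → x (inj₂ (ℓ , i))))
  sum-vertices x = trans (sum-↑ v (λ i → x (vertex i))) (+-cong
    (sum-cong-≋ λ p → reflexive (≡.cong (x ∘ Sum.map id (remQuot lam)) (splitAt-↑ˡ v p (v ℕ.* lam))))
    (trans (sum-combine v (λ b → x (vertex (v ↑ʳ b)))) (sum-cong-≋ λ ℓ → sum-cong-≋ λ i → reflexive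
      (≡.trans (≡.cong (x ∘ Sum.map id (remQuot lam)) (splitAt-↑ʳ v (v ℕ.* lam) (combine ℓ i)))
        (≡.cong (x ∘ inj₂) (remQuot-combine ℓ i))))))

  sum-others : ∀ {n} i (f : Fin n → Carrier) → sum (λ j → [ ¬? (i ≟ᶠ j) ] * f j) + f i ≈ sum f
  sum-others i f = begin
    sum (λ j → [ ¬? (i ≟ᶠ j) ] * f j) + f i                              ≈⟨ +-congˡ (sum-δ i f) ⟨
    sum (λ j → [ ¬? (i ≟ᶠ j) ] * f j) + sum (λ j → [ i ≟ᶠ j ] * f j)     ≈⟨ ∑-distrib-+ (λ j → [ ¬? (i ≟ᶠ j) ] * f j) _ ⟨
    sum (λ j → [ ¬? (i ≟ᶠ j) ] * f j + [ i ≟ᶠ j ] * f j)                 ≈⟨ sum-cong-≋ (λ j → split (i ≟ᶠ j) (f j)) ⟩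
    sum f                                                                ∎
    where
    split : ∀ {A : Set} (a? : Dec A) y → [ ¬? a? ] * y + [ a? ] * y ≈ y
    split (yes _) y = trans (+-cong (zeroˡ y) (*-identityˡ y)) (+-identityˡ y)
    split (no _)  y = trans (+-cong (*-identityˡ y) (zeroˡ y)) (+-identityʳ y)

  sum-other-copies : ∀ ℓ i (g : Fin v → Fin lam → Carrier) →
    sum (λ m → sum (λ j → [ inj₂ (ℓ , i) ⋈? inj₂ (m , j) ] * g m j)) + g ℓ i ≈ sum (g ℓ)
  sum-other-copies ℓ i g = trans (+-congʳ (trans
    (sum-single _ ℓ (λ m m≢ℓ → sum-0 λ j →
      trans (*-congʳ ([ inj₂ (ℓ , i) ⋈? inj₂ (m , j) ]≈0 λ (_ , ℓ≡m) → m≢ℓ (≡.sym ℓ≡m))) (zeroˡ _)))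
    (sum-cong-≋ λ j → *-congʳ (same j (i ≟ᶠ j)))))
    (sum-others i (g ℓ))
    where
    same : ∀ j (e : Dec (i ≡ j)) → [ inj₂ (ℓ , i) ⋈? inj₂ (ℓ , j) ] ≈ [ ¬? e ]
    same j (yes ≡.refl) = [ inj₂ (ℓ , i) ⋈? inj₂ (ℓ , j) ]≈0 λ (b≢b , _) → b≢b ≡.refl
    same j (no i≢j)     = [ inj₂ (ℓ , i) ⋈? inj₂ (ℓ , j) ]≈1 ((λ { ≡.refl → i≢j ≡.refl }) , ≡.refl)

  module _ (x : Vertex → Carrier) where

    -- A point is adjacent to every point but itself; adding the missing term on the left avoids
    -- subtraction. The same equation thus gives the degrees, with x = 1 over ℕ, and the action of
    -- the Laplacian over the ring.
    sum-neighbours-point : ∀ p →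
      sum (λ i → [ inj₁ p ⋈? vertex i ] * x (vertex i)) + x (inj₁ p)
        ≈ sum (λ q → x (inj₁ q)) + sum (λ ℓ → [ p I? ℓ ] * sum (λ i → x (inj₂ (ℓ , i))))
    sum-neighbours-point p = begin
      sum (λ i → [ inj₁ p ⋈? vertex i ] * x (vertex i)) + x (inj₁ p)
        ≈⟨ +-congʳ (sum-vertices (λ w → [ inj₁ p ⋈? w ] * x w)) ⟩
      A + sum (λ ℓ → sum (λ i → [ p I? ℓ ] * x (inj₂ (ℓ , i)))) + x (inj₁ p)
        ≈⟨ trans (+-assoc _ _ _) (trans (+-congˡ (+-comm _ _)) (sym (+-assoc _ _ _))) ⟩
      A + x (inj₁ p) + sum (λ ℓ → sum (λ i → [ p I? ℓ ] * x (inj₂ (ℓ , i))))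
        ≈⟨ +-cong (sum-others p (x ∘ inj₁))
             (sum-cong-≋ (λ ℓ → sym (*-distribˡ-sum [ p I? ℓ ] (λ i → x (inj₂ (ℓ , i)))))) ⟩
      sum (λ q → x (inj₁ q)) + sum (λ ℓ → [ p I? ℓ ] * sum (λ i → x (inj₂ (ℓ , i)))) ∎
      where A = sum (λ q → [ ¬? (p ≟ᶠ q) ] * x (inj₁ q))

    sum-neighbours-block : ∀ ℓ i →
      sum (λ j → [ inj₂ (ℓ , i) ⋈? vertex j ] * x (vertex j)) + x (inj₂ (ℓ , i))
        ≈ sum (λ p → [ p I? ℓ ] * x (inj₁ p)) + sum (λ j → x (inj₂ (ℓ , j)))
    sum-neighbours-block ℓ i = trans
      (+-congʳ (sum-vertices (λ w → [ inj₂ (ℓ , i) ⋈? w ] * x w)))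
      (trans (+-assoc _ _ _) (+-congˡ (sum-other-copies ℓ i (λ m j → x (inj₂ (m , j))))))

module Degrees {k v : ℕ} (Π : ProjectivePlane k v) (lam : ℕ) where
  open ProjectivePlane Π
  open Plane Π
  open RepeatedLines Π lam
  open Graph Γ using (vertex; degree)
  open Sums ℕₚ.+-*-commutativeSemiring
  open Gram ℕₚ.+-*-commutativeSemiring design
  open Neighbourhoods ℕₚ.+-*-commutativeSemiring Π lam
  open ≡.≡-Reasoning

  sum-1 : ∀ n → sum {n} (λ _ → 1) ≡ n
  sum-1 n = ≡.trans (sum-replicate n) (·1≡id n)

  degree≡ : ∀ u → degree u ≡ sum (λ i → [ u ⋈? vertex i ] ℕ.* 1)
  degree≡ u = ≡.trans (≡.sym (·1≡id (degree u))) (≡.trans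
    (count-tabulate (λ i → u ⋈? vertex i) id)
    (sum-cong-≗ λ i → ≡.sym (ℕₚ.*-identityʳ [ u ⋈? vertex i ])))

  degree-point : ∀ p → degree (inj₁ p) ℕ.+ 1 ≡ v ℕ.+ k ℕ.* lam
  degree-point p = begin
    degree (inj₁ p) ℕ.+ 1                                                    ≡⟨ ≡.cong (ℕ._+ 1) (degree≡ (inj₁ p)) ⟩
    sum (λ i → [ inj₁ p ⋈? vertex i ] ℕ.* 1) ℕ.+ 1                           ≡⟨ sum-neighbours-point (λ _ → 1) p ⟩
    sum {v} (λ _ → 1) ℕ.+ sum (λ ℓ → [ p I? ℓ ] ℕ.* sum {lam} (λ _ → 1))     ≡⟨ ≡.cong₂ ℕ._+_ (sum-1 v)
                                                                                 (sum-cong-≗ (λ ℓ → ≡.cong ([ p I? ℓ ] ℕ.*_) (sum-1 lam))) ⟩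
    v ℕ.+ sum (λ ℓ → [ p I? ℓ ] ℕ.* lam)                                     ≡⟨ ≡.cong (v ℕ.+_) (*-distribʳ-sum lam (λ ℓ → [ p I? ℓ ])) ⟨
    v ℕ.+ sum (λ ℓ → [ p I? ℓ ]) ℕ.* lam                                     ≡⟨ ≡.cong (λ n → v ℕ.+ n ℕ.* lam) (≡.trans (row-sum p) (·1≡id k)) ⟩
    v ℕ.+ k ℕ.* lam                                                          ∎

  degree-block : ∀ b → degree (inj₂ b) ℕ.+ 1 ≡ k ℕ.+ lam
  degree-block b@(ℓ , i) = begin
    degree (inj₂ b) ℕ.+ 1                                                    ≡⟨ ≡.cong (ℕ._+ 1) (degree≡ (inj₂ b)) ⟩
    sum (λ j → [ inj₂ b ⋈? vertex j ] ℕ.* 1) ℕ.+ 1                           ≡⟨ sum-neighbours-block (λ _ → 1) ℓ i ⟩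
    sum (λ p → [ p I? ℓ ] ℕ.* 1) ℕ.+ sum {lam} (λ _ → 1)                     ≡⟨ ≡.cong₂ ℕ._+_
                                                                                 (sum-cong-≗ (λ p → ℕₚ.*-identityʳ [ p I? ℓ ])) (sum-1 lam) ⟩
    sum (λ p → [ p I? ℓ ]) ℕ.+ lam                                           ≡⟨ ≡.cong (ℕ._+ lam) (≡.trans (column-sum ℓ) (·1≡id k)) ⟩
    k ℕ.+ lam                                                                ∎

-- Eigenvalues of the Laplacian of `Γ` over a commutative ring

module Eigenvector (R : CommutativeRing 0ℓ 0ℓ) (G : Graph) where
  open CommutativeRing R
  open Sums commutativeSemiring using (sum)
  open Graph G using (Vertex; vertex)

  Eigenvalue : (Vertex → Vertex → Carrier) → Carrier → Set
  Eigenvalue M θ = Σ[ x ∈ (Vertex → Carrier) ]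
    ¬ (∀ u → x u ≈ 0#) ×
    (∀ u → sum (λ i → M u (vertex i) * x (vertex i)) ≈ θ * x u)

module Dipoles (R : CommutativeRing 0ℓ 0ℓ) where
  open CommutativeRing R hiding (zero)
  open IntegerCoefficients R
  open Sums commutativeSemiring

  -- The simplest nonzero vector with sum 0. On the points it gives an eigenvector for θ₁, on the
  -- copies of each line one for θ₂.
  dipole : ∀ {n} → Fin n → Fin n → Fin n → Carrier
  dipole a b i = [ a ≟ᶠ i ] - [ b ≟ᶠ i ]

  sum-dipole : ∀ {n} (a b : Fin n) → sum (dipole a b) ≈ 0#
  sum-dipole a b = trans
    (sum-cong-≋ λ i → solve 2 (λ x y → x :- y := x :* 1′ :+ y :* :- 1′) refl [ a ≟ᶠ i ] [ b ≟ᶠ i ])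
    (trans (∑-distrib-+ (λ i → [ a ≟ᶠ i ] * 1#) (λ i → [ b ≟ᶠ i ] * (- 1#)))
      (trans (+-cong (sum-δ a (λ _ → 1#)) (sum-δ b (λ _ → - 1#))) (-‿inverseʳ 1#)))

  dipole-source : ∀ {n} {a b : Fin n} → a ≢ b → dipole a b a ≈ 1#
  dipole-source {a = a} {b} a≢b = trans
    (+-cong ([ a ≟ᶠ a ]≈1 ≡.refl) (-‿cong ([ b ≟ᶠ a ]≈0 λ b≡a → a≢b (≡.sym b≡a))))
    (solve 0 (1′ :- con (ℤ.+ 0) := 1′) refl)

module LaplacianOfΓ (R : CommutativeRing 0ℓ 0ℓ) {k v : ℕ} (Π : ProjectivePlane k v) (lam : ℕ)
  (W M : Graph.Vertex (RepeatedLines.Γ Π lam) → Graph.Vertex (RepeatedLines.Γ Π lam) → CommutativeRing.Carrier R)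
  (M≡laplacian : ∀ u w → M u w ≡ Laplacian.laplacian R (RepeatedLines.Γ Π lam) W u w) where
  open CommutativeRing R hiding (zero)
  open IntegerCoefficients R
  open Sums commutativeSemiring
  open ProjectivePlane Π
  open Plane Π
  open RepeatedLines Π lam
  open Graph Γ using (Vertex; vertex; degree)
  open LaplacianAction R Γ W M M≡laplacian
  open Neighbourhoods commutativeSemiring Π lam
  open PlaneAlgebra R design v+k≡1+k² lam
  open Eigenvector R Γ
  open Dipoles R

  module Entries {ρ β σ : Carrier}
    (degree≢0 : ∀ u → degree u ≢ 0)
    (W-point-point : ∀ p q → W (inj₁ p) (inj₁ q) ≈ ρ)
    (W-point-block : ∀ p b → W (inj₁ p) (inj₂ b) ≈ σ)
    (W-block-point : ∀ b p → W (inj₂ b) (inj₁ p) ≈ σ)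
    (W-block-block : ∀ b c → W (inj₂ b) (inj₂ c) ≈ β) where

    open Operator ρ β σ

    action-point : ∀ (x : Vertex → Carrier) p →
      sum (λ i → M (inj₁ p) (vertex i) * x (vertex i)) ≈ ℒᵖ (λ p → x (inj₁ p)) (λ ℓ i → x (inj₂ (ℓ , i))) p
    action-point x p = trans (laplacian-action (degree≢0 (inj₁ p)) x) (by-combination
      (solve 6 (λ ρ σ y n F t → y :- n := (y :- (ρ :* (F :- y) :+ σ :* t)) :+
          (:- 1′ :* ((n :+ ρ :* y) :- (ρ :* F :+ σ :* t)))) refl
        ρ σ (f p) (sum (λ i → [ inj₁ p ⋈? vertex i ] * y (vertex i))) (sum f) (sum (λ ℓ → [ p I? ℓ ] * sum (g ℓ))))
      (- 1# ⊛ neighbours))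
      where
      f : Fin v → Carrier
      f p = x (inj₁ p)
      g : Fin v → Fin lam → Carrier
      g ℓ i = x (inj₂ (ℓ , i))
      y : Vertex → Carrier
      y w = W (inj₁ p) w * x w
      neighbours : sum (λ i → [ inj₁ p ⋈? vertex i ] * y (vertex i)) + ρ * f p
        ≈ ρ * sum f + σ * sum (λ ℓ → [ p I? ℓ ] * sum (g ℓ))
      -- `W` has the value ρ at the non-adjacent pair (p, p) as well, so the term added back by
      -- `sum-neighbours-point` is ρ `f p`.
      neighbours = trans (+-congˡ (*-congʳ (sym (W-point-point p p)))) (trans (sum-neighbours-point y p) (+-cong
        (trans (sum-cong-≋ λ q → *-congʳ (W-point-point p q)) (sym (*-distribˡ-sum ρ f)))
        (trans
          (sum-cong-≋ λ ℓ → trans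
            (*-congˡ (trans (sum-cong-≋ λ i → *-congʳ (W-point-block p (ℓ , i))) (sym (*-distribˡ-sum σ (g ℓ)))))
            (solve 3 (λ a b c → a :* (b :* c) := b :* (a :* c)) refl [ p I? ℓ ] σ (sum (g ℓ))))
          (sym (*-distribˡ-sum σ (λ ℓ → [ p I? ℓ ] * sum (g ℓ)))))))

    action-block : ∀ (x : Vertex → Carrier) ℓ i →
      sum (λ j → M (inj₂ (ℓ , i)) (vertex j) * x (vertex j)) ≈ ℒᵇ (λ p → x (inj₁ p)) (λ ℓ i → x (inj₂ (ℓ , i))) ℓ i
    action-block x ℓ i = trans (laplacian-action (degree≢0 (inj₂ (ℓ , i))) x) (by-combination
      (solve 6 (λ β σ y n s G → y :- n := (y :- (σ :* s :+ β :* (G :- y))) :+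
          (:- 1′ :* ((n :+ β :* y) :- (σ :* s :+ β :* G)))) refl
        β σ (g ℓ i) (sum (λ j → [ inj₂ (ℓ , i) ⋈? vertex j ] * y (vertex j))) (sum (λ p → [ p I? ℓ ] * f p)) (sum (g ℓ)))
      (- 1# ⊛ neighbours))
      where
      f : Fin v → Carrier
      f p = x (inj₁ p)
      g : Fin v → Fin lam → Carrier
      g ℓ i = x (inj₂ (ℓ , i))
      y : Vertex → Carrier
      y w = W (inj₂ (ℓ , i)) w * x w
      neighbours : sum (λ j → [ inj₂ (ℓ , i) ⋈? vertex j ] * y (vertex j)) + β * g ℓ i
        ≈ σ * sum (λ p → [ p I? ℓ ] * f p) + β * sum (g ℓ)
      neighbours = trans (+-congˡ (*-congʳ (sym (W-block-block (ℓ , i) (ℓ , i))))) (trans (sum-neighbours-block y ℓ i) (+-cong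
        (trans
          (sum-cong-≋ λ p → trans (*-congˡ (*-congʳ (W-block-point (ℓ , i) p)))
            (solve 3 (λ a b c → a :* (b :* c) := b :* (a :* c)) refl [ p I? ℓ ] σ (f p)))
          (sym (*-distribˡ-sum σ (λ p → [ p I? ℓ ] * f p))))
        (trans (sum-cong-≋ λ j → *-congʳ (W-block-block (ℓ , i) (ℓ , j))) (sym (*-distribˡ-sum β (g ℓ))))))

    module Relations (c : Carrier)
      (κρ≈β : κ * ρ ≈ β) (Dβ≈1 : D * β ≈ 1#) (σσ≈ρβ : σ * σ ≈ ρ * β) (c[κ-1]≈1 : c * (κ - 1#) ≈ 1#) where

      open Spectrum ρ β σ c κρ≈β Dβ≈1 σσ≈ρβ c[κ-1]≈1

      -- An eigenvector is only known not to vanish everywhere, with no coordinate singled out;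
      -- hence the conclusion is a contradiction.
      eigenvalue-only : ∀ {θ} → Eigenvalue M θ →
        Cancellable θ → Cancellable (θ - θ₁) → Cancellable (θ - θ₂) → ⊥
      eigenvalue-only {θ} (x , x≉0 , Mx≈θx) cancel-θ cancel-θ₁ cancel-θ₂ = x≉0 λ where
          (inj₁ p)       → f≈0 eigen cancel-θ cancel-θ₁ cancel-θ₂ p
          (inj₂ (ℓ , i)) → g≈0 eigen cancel-θ cancel-θ₁ cancel-θ₂ ℓ i
        where
        eigen : Eigen θ (λ p → x (inj₁ p)) (λ ℓ i → x (inj₂ (ℓ , i)))
        eigen = (λ p → trans (sym (action-point x p)) (Mx≈θx (inj₁ p)))
              , λ ℓ i → trans (sym (action-block x ℓ i)) (Mx≈θx (inj₂ (ℓ , i)))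

      eigenvalue : ∀ {θ f g} → Eigen θ f g →
        ¬ ((∀ p → f p ≈ 0#) × (∀ ℓ i → g ℓ i ≈ 0#)) → ∀ {θ′} → θ′ ≈ θ → Eigenvalue M θ′
      eigenvalue {θ} {f} {g} (at-point , at-block) nonzero {θ′} θ′≈θ = x
        , (λ x≈0 → nonzero ((λ p → x≈0 (inj₁ p)) , λ ℓ i → x≈0 (inj₂ (ℓ , i))))
        , λ where
          (inj₁ p)       → trans (action-point x p) (trans (at-point p) (*-congʳ (sym θ′≈θ)))
          (inj₂ (ℓ , i)) → trans (action-block x ℓ i) (trans (at-block ℓ i) (*-congʳ (sym θ′≈θ)))
        where
        x : Vertex → Carrier
        x (inj₁ p)       = f p
        x (inj₂ (ℓ , i)) = g ℓ i

      module _ (1≉0 : ¬ 1# ≈ 0#) where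

        0-eigenvalue : Fin v → ∀ {θ} → θ ≈ 0# → Eigenvalue M θ
        0-eigenvalue p = eigenvalue eigen-0 λ (f≈0 , _) → 1≉0 (f≈0 p)

        θ₁-eigenvalue : ∀ {p q : Fin v} → p ≢ q → ∀ {θ} → θ ≈ θ₁ → Eigenvalue M θ
        θ₁-eigenvalue {p} {q} p≢q = eigenvalue (eigen-θ₁ (dipole p q) (sum-dipole p q))
          λ (f≈0 , _) → 1≉0 (trans (sym (dipole-source p≢q)) (f≈0 p))

        -- Two different copies of a line are what λ ≥ 2 provides; the same dipole is placed on the
        -- copies of every line.
        θ₂-eigenvalue : Fin v → ∀ {i j : Fin lam} → i ≢ j → ∀ {θ} → θ ≈ θ₂ → Eigenvalue M θ
        θ₂-eigenvalue ℓ {i} {j} i≢j = eigenvalue (eigen-θ₂ (λ _ → dipole i j) (λ _ → sum-dipole i j))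
          λ (_ , g≈0) → 1≉0 (trans (sym (dipole-source i≢j)) (g≈0 ℓ i))

open import Defs

-- Apartness and square roots in ℝ

module RealProperties where
  open import Data.Rational.Base using (_<_; _≤_; ∣_∣; _+_; _*_; _-_; -_; toℚᵘ)
  open ℚₚ

  p-q≡0⇒p≡q : ∀ p q → p - q ≡ 0ℚ → p ≡ q
  p-q≡0⇒p≡q = GroupProperties.x∙y⁻¹≈ε⇒x≈y +-0-group

  p≢q⇒0<∣p-q∣ : ∀ {p q} → p ≢ q → 0ℚ < ∣ p - q ∣
  p≢q⇒0<∣p-q∣ {p} {q} p≢q = ≰⇒> λ ∣p-q∣≤0 →
    p≢q (p-q≡0⇒p≡q p q (∣p∣≡0⇒p≡0 (p - q) (≤-antisym ∣p-q∣≤0 (0≤∣p∣ (p - q)))))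

  ∣p-q∣≡∣q-p∣ : ∀ p q → ∣ p - q ∣ ≡ ∣ q - p ∣
  ∣p-q∣≡∣q-p∣ p q = ≡.trans (≡.sym (∣-p∣≡∣p∣ (p - q)))
    (≡.cong ∣_∣ (solve 2 (λ p q → :- (p :- q) := q :- p) ≡.refl p q))
    where open +-*-Solver

  ∣p∣≤∣q∣+∣p-q∣ : ∀ p q → ∣ p ∣ ≤ ∣ q ∣ + ∣ p - q ∣
  ∣p∣≤∣q∣+∣p-q∣ p q = ≡.subst (λ r → ∣ r ∣ ≤ ∣ q ∣ + ∣ p - q ∣)
    (solve 2 (λ p q → q :+ (p :- q) := p) ≡.refl p q) (∣p+q∣≤∣p∣+∣q∣ q (p - q))
    where open +-*-Solver

  p≡p-0 : ∀ p → p ≡ p - 0ℚ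
  p≡p-0 p = ≡.sym (+-identityʳ p)

  fromℚ-injective : ∀ {p q} → fromℚ p ≈ fromℚ q → p ≡ q
  fromℚ-injective {p} {q} p≈q with p ≟ q
  ... | yes p≡q = p≡q
  ... | no  p≢q = let N , small = p≈q ∣ p - q ∣ (p≢q⇒0<∣p-q∣ p≢q) in
                  ⊥-elim (<-irrefl ≡.refl (small N ℕₚ.≤-refl))

  1≉0 : fromℚ 1ℚ ≉ fromℚ 0ℚ
  1≉0 1≈0 = contradiction (fromℚ-injective {1ℚ} {0ℚ} 1≈0) λ ()

  -- The constructive strengthening of `x ≉ 0`: it can be read off from one good rational
  -- approximation, and it gives a bound to cancel by.
  Apart : ℝ → Set
  Apart x = ∃[ δ ] (0ℚ < δ) × ∃[ N ] ∀ n → N ℕ.≤ n → δ ≤ ∣ seq x n ∣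

  Within : ℚ → ℕ → ℝ → Set
  Within δ N x = ∀ n → N ℕ.≤ n → ∣ seq x n - seq x N ∣ < δ

  within : ∀ x {δ} → 0ℚ < δ → ∃[ N ] Within δ N x
  within x 0<δ = let N , h = cauchy x _ 0<δ in N , λ n N≤n → h (n , N) (N≤n , ℕₚ.≤-refl)

  far⇒apart : ∀ x {δ N} → 0ℚ < δ → Within δ N x → δ + δ ≤ ∣ seq x N ∣ → Apart x
  far⇒apart x {δ} {N} 0<δ w far = δ , 0<δ , N , λ n N≤n → ≮⇒≥ λ ∣x∣<δ →
    <-irrefl ≡.refl (≤-<-trans (≤-trans far (∣p∣≤∣q∣+∣p-q∣ (seq x N) (seq x n)))
      (+-mono-< ∣x∣<δ (≡.subst (_< δ) (∣p-q∣≡∣q-p∣ (seq x n) (seq x N)) (w n N≤n))))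

  -- Take δ = ε/4 and a stage N after which x moves by less than δ. The rational comparison of the
  -- N-th term with 2δ is decidable: a large term would make x apart from 0, and a small one keeps
  -- all later terms below 3δ.
  tight : ∀ {x} → ¬ Apart x → x ≈ fromℚ 0ℚ
  tight {x} ¬apart ε 0<ε = let N , w = within x 0<δ in N , λ n N≤n → bound N w n N≤n
    where
    δ = ½ * (½ * ε)
    0<δ = 0<* 0<½ (0<* 0<½ 0<ε)
    bound : ∀ N → Within δ N x → ∀ n → N ℕ.≤ n → ∣ seq x n - 0ℚ ∣ < ε
    bound N w n N≤n with δ + δ ≤? ∣ seq x N ∣
    ... | yes far = contradiction (far⇒apart x 0<δ w far) ¬apart
    ... | no ¬far = ≡.subst (λ p → ∣ p ∣ < ε) (p≡p-0 (seq x n))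
      (≤-<-trans (∣p∣≤∣q∣+∣p-q∣ (seq x n) (seq x N))
        (≡.subst (∣ seq x N ∣ + ∣ seq x n - seq x N ∣ <_)
          (≡.trans (≡.cong (δ + δ +_) (≡.sym (½+½ _))) 4δ≡ε)
          (+-mono-< (≰⇒> ¬far) (<-trans (w n N≤n) δ<δ+δ))))
      where
      δ<δ+δ : δ < δ + δ
      δ<δ+δ = ≡.subst (_< δ + δ) (+-identityʳ δ) (+-monoʳ-< δ 0<δ)
      4δ≡ε : δ + δ + (½ * (δ + δ) + ½ * (δ + δ)) ≡ ε
      4δ≡ε = ≡.trans (≡.cong (δ + δ +_) (½+½ (δ + δ)))
        (≡.trans (≡.cong₂ _+_ (½+½ (½ * ε)) (½+½ (½ * ε))) (½+½ ε))

  -- With δ a quarter of the distance between p and q, an approximation of x cannot lie within 2δ of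
  -- both.
  located : ∀ x {p q} → p ≢ q → Apart (x +ᴿ -ᴿ fromℚ p) ⊎ Apart (x +ᴿ -ᴿ fromℚ q)
  located x {p} {q} p≢q = let N , w = within x 0<δ in go N w
    where
    d = ∣ p - q ∣
    δ = ½ * (½ * d)
    0<δ = 0<* 0<½ (0<* 0<½ (p≢q⇒0<∣p-q∣ p≢q))
    shift : ∀ {N} r → Within δ N x → Within δ N (x +ᴿ -ᴿ fromℚ r)
    shift {N} r w n N≤n = ≡.subst (λ s → ∣ s ∣ < δ)
      (solve 3 (λ a b r → a :- b := (a :- r) :- (b :- r)) ≡.refl (seq x n) (seq x N) r) (w n N≤n)
      where open +-*-Solver
    go : ∀ N → Within δ N x → Apart (x +ᴿ -ᴿ fromℚ p) ⊎ Apart (x +ᴿ -ᴿ fromℚ q)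
    go N w with δ + δ ≤? ∣ seq x N - p ∣ | δ + δ ≤? ∣ seq x N - q ∣
    ... | yes far | _       = inj₁ (far⇒apart (x +ᴿ -ᴿ fromℚ p) 0<δ (shift p w) far)
    ... | no _    | yes far = inj₂ (far⇒apart (x +ᴿ -ᴿ fromℚ q) 0<δ (shift q w) far)
    ... | no ¬p   | no ¬q   = ⊥-elim (<-irrefl ≡.refl (≤-<-trans
      (≡.subst (λ s → ∣ s ∣ ≤ ∣ seq x N - q ∣ + ∣ seq x N - p ∣)
        (solve 3 (λ a p q → (a :- q) :- (a :- p) := p :- q) ≡.refl (seq x N) p q)
        (∣p-q∣≤∣p∣+∣q∣ (seq x N - q) (seq x N - p)))
      (≡.subst (∣ seq x N - q ∣ + ∣ seq x N - p ∣ <_)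
        (≡.trans (≡.cong₂ _+_ (½+½ (½ * d)) (½+½ (½ * d))) (½+½ d))
        (+-mono-< (≰⇒> ¬q) (≰⇒> ¬p)))))
      where open +-*-Solver

  apart-cancel : ∀ {x y} → Apart x → x *ᴿ y ≈ fromℚ 0ℚ → y ≈ fromℚ 0ℚ
  apart-cancel {x} {y} (δ , 0<δ , M , δ≤∣x∣) xy≈0 ε 0<ε =
    let N , small = xy≈0 (δ * ε) (0<* 0<δ 0<ε) in
    M ℕ.⊔ N , λ n M⊔N≤n → ≡.subst (λ p → ∣ p ∣ < ε) (p≡p-0 (seq y n)) (≰⇒> λ ε≤∣y∣ →
      <-irrefl ≡.refl (≤-<-trans
        (*-mono (<⇒≤ 0<ε) (0≤∣p∣ (seq x n)) (δ≤∣x∣ n (ℕₚ.≤-trans (ℕₚ.m≤m⊔n M N) M⊔N≤n)) ε≤∣y∣)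
        (≡.subst (_< δ * ε)
          (≡.trans (≡.cong ∣_∣ (≡.sym (p≡p-0 (seq x n * seq y n)))) (∣p*q∣≡∣p∣*∣q∣ (seq x n) (seq y n)))
          (small n (ℕₚ.≤-trans (ℕₚ.m≤n⊔m M N) M⊔N≤n)))))

  -- `x ≉ 0` gives no bound on x, so the roles are exchanged: if y were apart from 0, cancelling y
  -- would make x zero. Hence y is not apart from 0, and `tight` applies.
  ≉0-cancel : ∀ {x y} → x ≉ fromℚ 0ℚ → x *ᴿ y ≈ fromℚ 0ℚ → y ≈ fromℚ 0ℚ
  ≉0-cancel {x} {y} x≉0 xy≈0 = tight {y} λ apart-y → x≉0 (apart-cancel {y} {x} apart-y
    (ℝ-ring.trans {y *ᴿ x} {x *ᴿ y} {fromℚ 0ℚ} (ℝ-ring.*-comm y x) xy≈0))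

  apart⇒≉ : ∀ {x y} → Apart (x +ᴿ -ᴿ y) → x ≉ y
  apart⇒≉ (δ , 0<δ , M , δ≤) x≈y =
    let N , small = x≈y δ 0<δ in
    <-irrefl ≡.refl (≤-<-trans (δ≤ (M ℕ.⊔ N) (ℕₚ.m≤m⊔n M N)) (small (M ℕ.⊔ N) (ℕₚ.m≤n⊔m M N)))

  ≈-stable : ∀ {x y} → ¬ x ≉ y → x ≈ y
  ≈-stable {x} {y} ¬x≉y = x-y≈0⇒x≈y (tight {x +ᴿ -ᴿ y} λ apart → ¬x≉y (apart⇒≉ {x} {y} apart))
    where
    x-y≈0⇒x≈y : x +ᴿ -ᴿ y ≈ fromℚ 0ℚ → x ≈ y
    x-y≈0⇒x≈y = GroupProperties.x∙y⁻¹≈ε⇒x≈y ℝ-ring.+-group x y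

  -- Distinct rationals are far apart, so θ can be told apart from all but one of them.
  one-of-three : ∀ θ {p q r} → p ≢ q → p ≢ r → q ≢ r →
    (θ ≉ fromℚ p → θ ≉ fromℚ q → θ ≉ fromℚ r → ⊥) →
    θ ≈ fromℚ p ⊎ θ ≈ fromℚ q ⊎ θ ≈ fromℚ r
  one-of-three θ {p} {q} {r} p≢q p≢r q≢r none =
    decide (located θ p≢q) (located θ p≢r) (located θ q≢r)
    where
    _#_ : ℝ → ℚ → Set
    x # s = Apart (x +ᴿ -ᴿ fromℚ s)
    ≉ : ∀ s → θ # s → θ ≉ fromℚ s
    ≉ s = apart⇒≉ {θ} {fromℚ s}
    decide : θ # p ⊎ θ # q → θ # p ⊎ θ # r → θ # q ⊎ θ # r →
      θ ≈ fromℚ p ⊎ θ ≈ fromℚ q ⊎ θ ≈ fromℚ r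
    -- Of the three comparisons, two always separate θ from different values; stability of equality
    -- then settles the third.
    decide (inj₁ p#) _         (inj₁ q#) = inj₂ (inj₂ (≈-stable {θ} {fromℚ r} (none (≉ p p#) (≉ q q#))))
    decide (inj₁ p#) _         (inj₂ r#) = inj₂ (inj₁ (≈-stable {θ} {fromℚ q} λ θ≉q → none (≉ p p#) θ≉q (≉ r r#)))
    decide (inj₂ q#) (inj₁ p#) _         = inj₂ (inj₂ (≈-stable {θ} {fromℚ r} (none (≉ p p#) (≉ q q#))))
    decide (inj₂ q#) (inj₂ r#) _         = inj₁ (≈-stable {θ} {fromℚ p} λ θ≉p → none θ≉p (≉ q q#) (≉ r r#))

  -- For nonnegative a and b, (a - b)² is at most the absolute value of a² - b², so ε² suffices as
  -- the bound on the squares.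
  square-injective : ∀ {x y} → (∀ n → 0ℚ ≤ seq x n) → (∀ n → 0ℚ ≤ seq y n) → x *ᴿ x ≈ y *ᴿ y → x ≈ y
  square-injective {x} {y} 0≤x 0≤y x²≈y² ε 0<ε =
    let N , small = x²≈y² (ε * ε) (0<* 0<ε 0<ε) in
    N , λ n N≤n → let a = seq x n ; b = seq y n in ≰⇒> λ ε≤∣a-b∣ →
      <-irrefl ≡.refl (≤-<-trans
        (*-mono (<⇒≤ 0<ε) (0≤∣p∣ (a - b)) ε≤∣a-b∣ (≤-trans ε≤∣a-b∣ (∣a-b∣≤∣a+b∣ (0≤x n) (0≤y n))))
        (≡.subst (_< ε * ε)
          (≡.trans (≡.cong ∣_∣ (factor a b)) (∣p*q∣≡∣p∣*∣q∣ (a - b) (a + b)))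
          (small n N≤n)))
    where
    open +-*-Solver
    factor : ∀ a b → a * a - b * b ≡ (a - b) * (a + b)
    factor = solve 2 (λ a b → a :* a :- b :* b := (a :- b) :* (a :+ b)) ≡.refl
    ∣a-b∣≤∣a+b∣ : ∀ {a b} → 0ℚ ≤ a → 0ℚ ≤ b → ∣ a - b ∣ ≤ ∣ a + b ∣
    ∣a-b∣≤∣a+b∣ {a} {b} 0≤a 0≤b = ≤-trans (∣p-q∣≤∣p∣+∣q∣ a b) (≤-reflexive
      (≡.trans (≡.cong₂ _+_ (0≤p⇒∣p∣≡p 0≤a) (0≤p⇒∣p∣≡p 0≤b))
        (≡.sym (0≤p⇒∣p∣≡p (+-mono-≤ {0ℚ} {a} {0ℚ} {b} 0≤a 0≤b)))))

  -- Meant for the weights between two points or between two blocks, whose radicands are squares of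
  -- rationals.
  √-square-root : ∀ {p q} → 0ℚ ≤ p → p * p ≡ q → √ q ≈ fromℚ p
  √-square-root {p} {q} 0≤p ≡.refl = square-injective {√ q} {fromℚ p}
    (√-nonNegative (0≤p*p p)) (λ _ → 0≤p) (√-square (0≤p*p p))

  ℕ→ℚ-injective : ∀ {m n} → ℕ→ℚ m ≡ ℕ→ℚ n → m ≡ n
  ℕ→ℚ-injective ≡.refl = ≡.refl

  ℕ→ℚ-+ : ∀ m n → ℕ→ℚ (m ℕ.+ n) ≡ ℕ→ℚ m + ℕ→ℚ n
  ℕ→ℚ-+ zero    n = ≡.sym (+-identityˡ (ℕ→ℚ n))
  ℕ→ℚ-+ (suc m) n = ≡.trans (ℕ→ℚ-suc (m ℕ.+ n)) (≡.trans (≡.cong (1ℚ +_) (ℕ→ℚ-+ m n))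
    (≡.trans (≡.sym (+-assoc 1ℚ (ℕ→ℚ m) (ℕ→ℚ n))) (≡.cong (_+ ℕ→ℚ n) (≡.sym (ℕ→ℚ-suc m)))))

  ℕ→ℚ-* : ∀ m n → ℕ→ℚ (m ℕ.* n) ≡ ℕ→ℚ m * ℕ→ℚ n
  ℕ→ℚ-* zero    n = ≡.sym (*-zeroˡ (ℕ→ℚ n))
  ℕ→ℚ-* (suc m) n = ≡.trans (ℕ→ℚ-+ n (m ℕ.* n)) (≡.trans (≡.cong (ℕ→ℚ n +_) (ℕ→ℚ-* m n))
    (≡.trans (solve 2 (λ m n → n :+ m :* n := (con 1ℚ :+ m) :* n) ≡.refl (ℕ→ℚ m) (ℕ→ℚ n))
      (≡.cong (_* ℕ→ℚ n) (≡.sym (ℕ→ℚ-suc m)))))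
    where open +-*-Solver

  ÷ₙ-* : ∀ m n .{{_ : ℕ.NonZero n}} → (m ÷ₙ n) * ℕ→ℚ n ≡ ℕ→ℚ m
  ÷ₙ-* m (suc n) = toℚᵘ-injective (ℚᵘₚ.≃-trans (toℚᵘ-homo-* (m ÷ₙ suc n) (ℕ→ℚ (suc n)))
    (ℚᵘₚ.≃-trans (ℚᵘₚ.*-congʳ (toℚᵘ-fromℚᵘ (ℚᵘ.mkℚᵘ (ℤ.+ m) n)))
      (ℚᵘ.*≡* (ℤₚ.*-assoc (ℤ.+ m) (ℤ.+ suc n) (ℤ.+ 1)))))

  *-cancelʳ-≡ : ∀ n .{{_ : ℕ.NonZero n}} {p q} → p * ℕ→ℚ n ≡ q * ℕ→ℚ n → p ≡ q
  *-cancelʳ-≡ (suc n) eq = ≤-antisym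
    (*-cancelʳ-≤-pos (ℕ→ℚ (suc n)) (≤-reflexive eq))
    (*-cancelʳ-≤-pos (ℕ→ℚ (suc n)) (≤-reflexive (≡.sym eq)))

  0≤÷ₙ : ∀ m n → 0ℚ ≤ m ÷ₙ n
  0≤÷ₙ m zero    = ≤-refl
  0≤÷ₙ m (suc n) = nonNegative⁻¹ (m ÷ₙ suc n) {{normalize-nonNeg m (suc n)}}

  1÷ₙ-* : ∀ m n .{{_ : ℕ.NonZero m}} .{{_ : ℕ.NonZero n}} → (1 ÷ₙ m) * (1 ÷ₙ n) ≡ 1 ÷ₙ (m ℕ.* n)
  1÷ₙ-* m n = *-cancelʳ-≡ (m ℕ.* n) {{ℕₚ.m*n≢0 m n}} (begin
    (1 ÷ₙ m) * (1 ÷ₙ n) * ℕ→ℚ (m ℕ.* n)       ≡⟨ ≡.cong ((1 ÷ₙ m) * (1 ÷ₙ n) *_) (ℕ→ℚ-* m n) ⟩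
    (1 ÷ₙ m) * (1 ÷ₙ n) * (ℕ→ℚ m * ℕ→ℚ n)     ≡⟨ solve 4 (λ a b c d → a :* b :* (c :* d) := a :* c :* (b :* d)) ≡.refl (1 ÷ₙ m) (1 ÷ₙ n) (ℕ→ℚ m) (ℕ→ℚ n) ⟩
    (1 ÷ₙ m) * ℕ→ℚ m * ((1 ÷ₙ n) * ℕ→ℚ n)     ≡⟨ ≡.cong₂ _*_ (÷ₙ-* 1 m) (÷ₙ-* 1 n) ⟩
    1ℚ                                        ≡⟨ ÷ₙ-* 1 (m ℕ.* n) {{ℕₚ.m*n≢0 m n}} ⟨
    (1 ÷ₙ (m ℕ.* n)) * ℕ→ℚ (m ℕ.* n)          ∎)
    where
    open +-*-Solver
    open ≡.≡-Reasoning

-- Specialization to the real Laplacian of `Γ`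

open RealProperties
open import Data.Nat.Base using (ℕ; _+_; _*_; _∸_; _≤_)

open Sums ℝ-ring.commutativeSemiring using (_·_)

seq-· : ∀ m n → seq (m · fromℚ 1ℚ) n ≡ ℕ→ℚ m
seq-· zero    n = ≡.refl
seq-· (suc m) n = ≡.trans (≡.cong (1ℚ ℚ.+_) (seq-· m n)) (≡.sym (ℕ→ℚ-suc m))

-- The two notions agree by unfolding; this is checked once, for a variable matrix.
Eigenvalue⇒IsEigenvalue : ∀ G M θ → Eigenvector.Eigenvalue ℝ-commutativeRing G M θ → Graph.IsEigenvalue G M θ
Eigenvalue⇒IsEigenvalue _ _ _ e = e

IsEigenvalue⇒Eigenvalue : ∀ G M θ → Graph.IsEigenvalue G M θ → Eigenvector.Eigenvalue ℝ-commutativeRing G M θ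
IsEigenvalue⇒Eigenvalue _ _ _ e = e

ℒ≡laplacian : ∀ G u w → Graph.ℒ G u w ≡
  Laplacian.laplacian ℝ-commutativeRing G (λ u w → √ (1 ÷ₙ (Graph.degree G u * Graph.degree G w))) u w
ℒ≡laplacian G u w = entry (does (u ≟ᵛ w)) (does (degree u ℕₚ.≟ 0)) (does (u ~? w)) (√ (1 ÷ₙ (degree u * degree w)))
  where
  open Graph G using (degree; _≟ᵛ_; _~?_)
  entry : ∀ a b c r →
    (if a then (if b then fromℚ 0ℚ else fromℚ 1ℚ) else if c then -ᴿ r else fromℚ 0ℚ) ≡
    (if a then (if b then ℝ-ring.0# else ℝ-ring.1#) else if c then ℝ-ring.- r else ℝ-ring.0#)
  entry _ _ _ _ = ≡.refl

open SetoidMembership ℝ-ring.setoid using (_∈_)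
open SetoidUnique ℝ-ring.setoid using (Unique)

-- Quantifying over `W` and `M` keeps the entries of `ℒ` opaque throughout the computation of the
-- spectrum.
distinctℒEigenvalues : ∀ G θs → Unique θs →
  (∀ W M → (∀ u w → W u w ≡ √ (1 ÷ₙ (Graph.degree G u * Graph.degree G w))) →
    (∀ u w → M u w ≡ Laplacian.laplacian ℝ-commutativeRing G W u w) →
    ∀ θ → Graph.IsEigenvalue G M θ ⇔ θ ∈ θs) →
  Graph.DistinctℒEigenvalues G θs
distinctℒEigenvalues G θs unique eigenvalues =
  unique , eigenvalues (λ u w → √ (1 ÷ₙ (Graph.degree G u * Graph.degree G w))) (Graph.ℒ G) (λ _ _ → ≡.refl) (ℒ≡laplacian G)

two-elements : ∀ {n} → 2 ≤ n → ∃₂ λ (a b : Fin n) → a ≢ b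
two-elements (s≤s (s≤s z≤n)) = zero , suc zero , λ ()

module RepeatedPlane {k v : ℕ} (Π : ProjectivePlane k v) (lam : ℕ) (2≤lam : 2 ≤ lam) where
  open ProjectivePlane Π using (2≤k)
  open Plane Π using (v+k≡1+k²; design)
  open RepeatedLines Π lam using (Γ)
  open Graph Γ using (degree)
  open Degrees Π lam using (degree-point; degree-block)
  open PlaneAlgebra ℝ-commutativeRing design v+k≡1+k² lam

  lam′ dᵖ dᵇ : ℕ
  lam′ = lam ∸ 1
  dᵖ = k * k + k * (lam ∸ 1)
  dᵇ = k + lam ∸ 1

  lam≡ : lam ≡ suc lam′
  lam≡ = ≡.sym (ℕₚ.m+[n∸m]≡n (ℕₚ.≤-trans (s≤s z≤n) 2≤lam))

  1≤lam′ : 1 ≤ lam′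
  1≤lam′ = ℕₚ.∸-monoˡ-≤ 1 2≤lam

  dᵇ≡ : dᵇ ≡ k + lam′
  dᵇ≡ = ≡.trans (≡.cong (λ n → k + n ∸ 1) lam≡) (≡.cong (_∸ 1) (ℕₚ.+-suc k lam′))

  k*dᵇ≡dᵖ : k * dᵇ ≡ dᵖ
  k*dᵇ≡dᵖ = ≡.trans (≡.cong (k *_) dᵇ≡) (ℕₚ.*-distribˡ-+ k k lam′)

  k≡1+[k∸1] : k ≡ 1 + (k ∸ 1)
  k≡1+[k∸1] = ≡.sym (ℕₚ.m+[n∸m]≡n (ℕₚ.≤-trans (s≤s z≤n) 2≤k))

  instance
    k≢0 : ℕ.NonZero k
    k≢0 = ℕ.>-nonZero (ℕₚ.≤-trans (s≤s z≤n) 2≤k)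
    k∸1≢0 : ℕ.NonZero (k ∸ 1)
    k∸1≢0 = ℕ.>-nonZero (ℕₚ.∸-monoˡ-≤ 1 2≤k)
    dᵇ≢0 : ℕ.NonZero dᵇ
    dᵇ≢0 = ≡.subst ℕ.NonZero (≡.sym dᵇ≡) (ℕ.>-nonZero (ℕₚ.≤-trans 1≤lam′ (ℕₚ.m≤n+m lam′ k)))
    dᵖ≢0 : ℕ.NonZero dᵖ
    dᵖ≢0 = ≡.subst ℕ.NonZero k*dᵇ≡dᵖ (ℕₚ.m*n≢0 k dᵇ)

  degree-point≡ : ∀ p → degree (inj₁ p) ≡ dᵖ
  degree-point≡ p = ℕₚ.+-cancelʳ-≡ 1 _ _ (begin
    degree (inj₁ p) + 1    ≡⟨ degree-point p ⟩
    v + k * lam            ≡⟨ ≡.cong (λ n → v + k * n) lam≡ ⟩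
    v + k * suc lam′       ≡⟨ ≡.cong (v +_) (ℕₚ.*-suc k lam′) ⟩
    v + (k + k * lam′)     ≡⟨ ℕₚ.+-assoc v k _ ⟨
    v + k + k * lam′       ≡⟨ ≡.cong (_+ k * lam′) v+k≡1+k² ⟩
    1 + dᵖ                 ≡⟨ ℕₚ.+-comm 1 dᵖ ⟩
    dᵖ + 1                 ∎)
    where open ≡.≡-Reasoning

  degree-block≡ : ∀ b → degree (inj₂ b) ≡ dᵇ
  degree-block≡ b = ℕₚ.+-cancelʳ-≡ 1 _ _ (begin
    degree (inj₂ b) + 1    ≡⟨ degree-block b ⟩
    k + lam                ≡⟨ ≡.cong (k +_) lam≡ ⟩
    k + suc lam′           ≡⟨ ℕₚ.+-suc k lam′ ⟩
    1 + (k + lam′)         ≡⟨ ≡.cong (1 +_) dᵇ≡ ⟨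
    1 + dᵇ                 ≡⟨ ℕₚ.+-comm 1 dᵇ ⟩
    dᵇ + 1                 ∎)
    where open ≡.≡-Reasoning

  degree≢0 : ∀ u → degree u ≢ 0
  degree≢0 (inj₁ p) d≡0 = ℕ.≢-nonZero⁻¹ dᵖ (≡.trans (≡.sym (degree-point≡ p)) d≡0)
  degree≢0 (inj₂ b) d≡0 = ℕ.≢-nonZero⁻¹ dᵇ (≡.trans (≡.sym (degree-block≡ b)) d≡0)

  k/dᵖ≡1/dᵇ : ℕ→ℚ k ℚ.* (1 ÷ₙ dᵖ) ≡ 1 ÷ₙ dᵇ
  k/dᵖ≡1/dᵇ = *-cancelʳ-≡ dᵇ (begin
    ℕ→ℚ k ℚ.* (1 ÷ₙ dᵖ) ℚ.* ℕ→ℚ dᵇ     ≡⟨ solve 3 (λ a b c → a :* b :* c := b :* (a :* c)) ≡.refl (ℕ→ℚ k) (1 ÷ₙ dᵖ) (ℕ→ℚ dᵇ) ⟩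
    (1 ÷ₙ dᵖ) ℚ.* (ℕ→ℚ k ℚ.* ℕ→ℚ dᵇ)   ≡⟨ ≡.cong ((1 ÷ₙ dᵖ) ℚ.*_) (≡.trans (≡.sym (ℕ→ℚ-* k dᵇ)) (≡.cong ℕ→ℚ k*dᵇ≡dᵖ)) ⟩
    (1 ÷ₙ dᵖ) ℚ.* ℕ→ℚ dᵖ               ≡⟨ ÷ₙ-* 1 dᵖ ⟩
    1ℚ                                 ≡⟨ ÷ₙ-* 1 dᵇ ⟨
    (1 ÷ₙ dᵇ) ℚ.* ℕ→ℚ dᵇ               ∎)
    where
    open ≡.≡-Reasoning
    open +-*-Solver

  v/dᵖ≡v*1/dᵖ : v ÷ₙ dᵖ ≡ ℕ→ℚ v ℚ.* (1 ÷ₙ dᵖ)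
  v/dᵖ≡v*1/dᵖ = *-cancelʳ-≡ dᵖ (begin
    (v ÷ₙ dᵖ) ℚ.* ℕ→ℚ dᵖ               ≡⟨ ÷ₙ-* v dᵖ ⟩
    ℕ→ℚ v                              ≡⟨ ℚₚ.*-identityʳ (ℕ→ℚ v) ⟨
    ℕ→ℚ v ℚ.* 1ℚ                       ≡⟨ ≡.cong (ℕ→ℚ v ℚ.*_) (÷ₙ-* 1 dᵖ) ⟨
    ℕ→ℚ v ℚ.* ((1 ÷ₙ dᵖ) ℚ.* ℕ→ℚ dᵖ)   ≡⟨ ℚₚ.*-assoc (ℕ→ℚ v) (1 ÷ₙ dᵖ) (ℕ→ℚ dᵖ) ⟨
    ℕ→ℚ v ℚ.* (1 ÷ₙ dᵖ) ℚ.* ℕ→ℚ dᵖ     ∎)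
    where open ≡.≡-Reasoning

  ρ β σ c : ℝ
  ρ = fromℚ (1 ÷ₙ dᵖ)
  β = fromℚ (1 ÷ₙ dᵇ)
  σ = √ (1 ÷ₙ (dᵖ * dᵇ))
  c = fromℚ (1 ÷ₙ (k ∸ 1))

  κρ≈β : κ *ᴿ ρ ≈ β
  κρ≈β = ≈-pointwise {κ *ᴿ ρ} {β} λ n → ≡.trans (≡.cong (ℚ._* (1 ÷ₙ dᵖ)) (seq-· k n)) k/dᵖ≡1/dᵇ

  Dβ≈1 : D *ᴿ β ≈ fromℚ 1ℚ
  Dβ≈1 = ≈-pointwise {D *ᴿ β} {fromℚ 1ℚ} λ n → begin
    (seq κ n ℚ.+ seq Λ n ℚ.- 1ℚ) ℚ.* (1 ÷ₙ dᵇ)           ≡⟨ ≡.cong₂ (λ a b → (a ℚ.+ b ℚ.- 1ℚ) ℚ.* (1 ÷ₙ dᵇ)) (seq-· k n)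
                                                             (≡.trans (seq-· lam n) (≡.trans (≡.cong ℕ→ℚ lam≡) (ℕ→ℚ-suc lam′))) ⟩
    (ℕ→ℚ k ℚ.+ (1ℚ ℚ.+ ℕ→ℚ lam′) ℚ.- 1ℚ) ℚ.* (1 ÷ₙ dᵇ)   ≡⟨ solve 3 (λ a b c → (a :+ (con 1ℚ :+ b) :- con 1ℚ) :* c := c :* (a :+ b)) ≡.refl
                                                             (ℕ→ℚ k) (ℕ→ℚ lam′) (1 ÷ₙ dᵇ) ⟩
    (1 ÷ₙ dᵇ) ℚ.* (ℕ→ℚ k ℚ.+ ℕ→ℚ lam′)                   ≡⟨ ≡.cong ((1 ÷ₙ dᵇ) ℚ.*_) (≡.trans (≡.sym (ℕ→ℚ-+ k lam′)) (≡.cong ℕ→ℚ (≡.sym dᵇ≡))) ⟩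
    (1 ÷ₙ dᵇ) ℚ.* ℕ→ℚ dᵇ                                 ≡⟨ ÷ₙ-* 1 dᵇ ⟩
    1ℚ                                                   ∎
    where
    open ≡.≡-Reasoning
    open +-*-Solver

  σσ≈ρβ : σ *ᴿ σ ≈ ρ *ᴿ β
  σσ≈ρβ = ≈-trans {σ *ᴿ σ} {fromℚ (1 ÷ₙ (dᵖ * dᵇ))} {ρ *ᴿ β}
    (√-square (0≤÷ₙ 1 (dᵖ * dᵇ)))
    (≈-pointwise {fromℚ (1 ÷ₙ (dᵖ * dᵇ))} {ρ *ᴿ β} λ _ → ≡.sym (1÷ₙ-* dᵖ dᵇ))

  c[κ-1]≈1 : c *ᴿ (κ +ᴿ -ᴿ fromℚ 1ℚ) ≈ fromℚ 1ℚ
  c[κ-1]≈1 = ≈-pointwise {c *ᴿ (κ +ᴿ -ᴿ fromℚ 1ℚ)} {fromℚ 1ℚ} λ n → begin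
    q ℚ.* (seq κ n ℚ.- 1ℚ)                 ≡⟨ ≡.cong (λ a → q ℚ.* (a ℚ.- 1ℚ))
                                               (≡.trans (seq-· k n) (≡.trans (≡.cong ℕ→ℚ k≡1+[k∸1]) (ℕ→ℚ-suc (k ∸ 1)))) ⟩
    q ℚ.* (1ℚ ℚ.+ ℕ→ℚ (k ∸ 1) ℚ.- 1ℚ)      ≡⟨ solve 2 (λ a b → a :* (con 1ℚ :+ b :- con 1ℚ) := a :* b) ≡.refl q (ℕ→ℚ (k ∸ 1)) ⟩
    q ℚ.* ℕ→ℚ (k ∸ 1)                      ≡⟨ ÷ₙ-* 1 (k ∸ 1) ⟩
    1ℚ                                     ∎
    where
    q = 1 ÷ₙ (k ∸ 1)
    open ≡.≡-Reasoning
    open +-*-Solver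

  open Operator ρ β σ
  open Spectrum ρ β σ c κρ≈β Dβ≈1 σσ≈ρβ c[κ-1]≈1

  q₁ q₂ : ℚ
  q₁ = v ÷ₙ dᵖ
  q₂ = 1ℚ ℚ.+ 1 ÷ₙ dᵇ

  q₁≈θ₁ : fromℚ q₁ ≈ θ₁
  q₁≈θ₁ = ≈-pointwise {fromℚ q₁} {θ₁} λ n → ≡.trans v/dᵖ≡v*1/dᵖ (≡.cong (ℚ._* (1 ÷ₙ dᵖ)) (≡.sym (seq-· v n)))

  q₂≈θ₂ : fromℚ q₂ ≈ θ₂
  q₂≈θ₂ = ≈-pointwise {fromℚ q₂} {θ₂} λ _ → ≡.refl

  -- From k ≥ 2, 2 k ≤ k² = v + k - 1. It supplies the two distinct points for the dipole.
  k<v : k ℕ.< v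
  k<v = ℕₚ.+-cancelʳ-≤ k (suc k) v (≡.subst (suc k + k ≤_) (≡.sym v+k≡1+k²)
    (s≤s (ℕₚ.≤-trans (ℕₚ.≤-reflexive (≡.cong (k +_) (≡.sym (ℕₚ.+-identityʳ k)))) (ℕₚ.*-monoˡ-≤ k 2≤k))))

  -- 0, q₁ and q₂ are distinct because their multiples by dᵖ are the naturals 0, v and dᵖ + k.
  q₂*dᵖ : q₂ ℚ.* ℕ→ℚ dᵖ ≡ ℕ→ℚ (dᵖ + k)
  q₂*dᵖ = begin
    (1ℚ ℚ.+ 1 ÷ₙ dᵇ) ℚ.* ℕ→ℚ dᵖ                          ≡⟨ ≡.cong (λ r → (1ℚ ℚ.+ r) ℚ.* ℕ→ℚ dᵖ) k/dᵖ≡1/dᵇ ⟨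
    (1ℚ ℚ.+ ℕ→ℚ k ℚ.* (1 ÷ₙ dᵖ)) ℚ.* ℕ→ℚ dᵖ              ≡⟨ solve 3 (λ a b c → (con 1ℚ :+ a :* b) :* c := c :+ a :* (b :* c)) ≡.refl
                                                             (ℕ→ℚ k) (1 ÷ₙ dᵖ) (ℕ→ℚ dᵖ) ⟩
    ℕ→ℚ dᵖ ℚ.+ ℕ→ℚ k ℚ.* ((1 ÷ₙ dᵖ) ℚ.* ℕ→ℚ dᵖ)          ≡⟨ ≡.cong (λ r → ℕ→ℚ dᵖ ℚ.+ ℕ→ℚ k ℚ.* r) (÷ₙ-* 1 dᵖ) ⟩
    ℕ→ℚ dᵖ ℚ.+ ℕ→ℚ k ℚ.* 1ℚ                              ≡⟨ ≡.cong (ℕ→ℚ dᵖ ℚ.+_) (ℚₚ.*-identityʳ (ℕ→ℚ k)) ⟩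
    ℕ→ℚ dᵖ ℚ.+ ℕ→ℚ k                                     ≡⟨ ℕ→ℚ-+ dᵖ k ⟨
    ℕ→ℚ (dᵖ + k)                                         ∎
    where
    open ≡.≡-Reasoning
    open +-*-Solver

  distinct : ∀ {p q m n} → p ℚ.* ℕ→ℚ dᵖ ≡ ℕ→ℚ m → q ℚ.* ℕ→ℚ dᵖ ≡ ℕ→ℚ n → m ℕ.< n → p ≢ q
  distinct p*dᵖ≡m q*dᵖ≡n m<n p≡q = ℕₚ.<⇒≢ m<n (ℕ→ℚ-injective
    (≡.trans (≡.sym p*dᵖ≡m) (≡.trans (≡.cong (ℚ._* ℕ→ℚ dᵖ) p≡q) q*dᵖ≡n)))

  0<v : 0 ℕ.< v
  0<v = ℕₚ.≤-<-trans z≤n k<v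

  v<dᵖ+k : v ℕ.< dᵖ + k
  v<dᵖ+k = ℕₚ.+-cancelʳ-≤ k (suc v) (dᵖ + k) (begin
    suc (v + k)             ≡⟨ ≡.cong suc v+k≡1+k² ⟩
    2 + k * k               ≤⟨ ℕₚ.+-mono-≤ 2≤k (ℕₚ.m≤m+n (k * k) (k * lam′)) ⟩
    k + dᵖ                  ≡⟨ ℕₚ.+-comm k dᵖ ⟩
    dᵖ + k                  ≤⟨ ℕₚ.m≤m+n (dᵖ + k) k ⟩
    dᵖ + k + k              ∎)
    where open ℕₚ.≤-Reasoning

  0≢q₁ : 0ℚ ≢ q₁
  0≢q₁ = distinct {0ℚ} {q₁} (ℚₚ.*-zeroˡ (ℕ→ℚ dᵖ)) (÷ₙ-* v dᵖ) 0<v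

  0≢q₂ : 0ℚ ≢ q₂
  0≢q₂ = distinct {0ℚ} {q₂} (ℚₚ.*-zeroˡ (ℕ→ℚ dᵖ)) q₂*dᵖ (ℕₚ.<-trans 0<v v<dᵖ+k)

  q₁≢q₂ : q₁ ≢ q₂
  q₁≢q₂ = distinct {q₁} {q₂} (÷ₙ-* v dᵖ) q₂*dᵖ v<dᵖ+k

  cancel-difference : ∀ {θ t q} → q ≈ t → θ ≉ q → Cancellable (θ +ᴿ -ᴿ t)
  cancel-difference {θ} {t} {q} q≈t θ≉q y = ≉0-cancel {θ +ᴿ -ᴿ t} {y} λ θ-t≈0 → θ≉q
    (≈-trans {θ} {t} {q} (GroupProperties.x∙y⁻¹≈ε⇒x≈y ℝ-ring.+-group θ t θ-t≈0) (≈-sym {q} {t} q≈t))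

  2≤v : 2 ≤ v
  2≤v = ℕₚ.≤-trans 2≤k (ℕₚ.<⇒≤ k<v)

  module _ (W M : Graph.Vertex (RepeatedLines.Γ Π lam) → Graph.Vertex (RepeatedLines.Γ Π lam) → ℝ)
    (W≡weight : ∀ u w → W u w ≡ √ (1 ÷ₙ (degree u * degree w)))
    (M≡laplacian : ∀ u w → M u w ≡ Laplacian.laplacian ℝ-commutativeRing (RepeatedLines.Γ Π lam) W u w) where

    W-degrees : ∀ {u w a b} → degree u ≡ a → degree w ≡ b → W u w ≈ √ (1 ÷ₙ (a * b))
    W-degrees {u} {w} {a} {b} eq eq′ = ℝ-ring.reflexive {W u w} {√ (1 ÷ₙ (a * b))}
      (≡.trans (W≡weight u w) (≡.cong₂ (λ a b → √ (1 ÷ₙ (a * b))) eq eq′))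

    W-point-point : ∀ p q → W (inj₁ p) (inj₁ q) ≈ ρ
    W-point-point p q = ≈-trans {W (inj₁ p) (inj₁ q)} {√ (1 ÷ₙ (dᵖ * dᵖ))} {ρ}
      (W-degrees {inj₁ p} {inj₁ q} (degree-point≡ p) (degree-point≡ q))
      (√-square-root (0≤÷ₙ 1 dᵖ) (1÷ₙ-* dᵖ dᵖ))

    W-point-block : ∀ p b → W (inj₁ p) (inj₂ b) ≈ σ
    W-point-block p b = W-degrees {inj₁ p} {inj₂ b} (degree-point≡ p) (degree-block≡ b)

    W-block-point : ∀ b p → W (inj₂ b) (inj₁ p) ≈ σ
    -- σ has the degree product in the order point, block; here it arises reversed.
    W-block-point b p = ≡.subst (λ d → W (inj₂ b) (inj₁ p) ≈ √ (1 ÷ₙ d)) (ℕₚ.*-comm dᵇ dᵖ)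
      (W-degrees {inj₂ b} {inj₁ p} (degree-block≡ b) (degree-point≡ p))

    W-block-block : ∀ b b′ → W (inj₂ b) (inj₂ b′) ≈ β
    W-block-block b b′ = ≈-trans {W (inj₂ b) (inj₂ b′)} {√ (1 ÷ₙ (dᵇ * dᵇ))} {β}
      (W-degrees {inj₂ b} {inj₂ b′} (degree-block≡ b) (degree-block≡ b′))
      (√-square-root (0≤÷ₙ 1 dᵇ) (1÷ₙ-* dᵇ dᵇ))

    open LaplacianOfΓ.Entries.Relations ℝ-commutativeRing Π lam W M M≡laplacian {ρ} {β} {σ}
      degree≢0 W-point-point W-point-block W-block-point W-block-block c κρ≈β Dβ≈1 σσ≈ρβ c[κ-1]≈1
    open Eigenvector ℝ-commutativeRing Γ using (Eigenvalue)

    θ∈0,q₁,q₂ : ∀ {θ} → Eigenvalue M θ → θ ≈ fromℚ 0ℚ ⊎ θ ≈ fromℚ q₁ ⊎ θ ≈ fromℚ q₂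
    θ∈0,q₁,q₂ {θ} e = one-of-three θ 0≢q₁ 0≢q₂ q₁≢q₂ λ θ≉0 θ≉q₁ θ≉q₂ →
      eigenvalue-only {θ} e (λ y → ≉0-cancel {θ} {y} θ≉0)
        (cancel-difference {θ} {θ₁} {fromℚ q₁} q₁≈θ₁ θ≉q₁)
        (cancel-difference {θ} {θ₂} {fromℚ q₂} q₂≈θ₂ θ≉q₂)

    θ≈0⇒eigenvalue : ∀ {θ} → θ ≈ fromℚ 0ℚ → Eigenvalue M θ
    θ≈0⇒eigenvalue {θ} = 0-eigenvalue 1≉0 (proj₁ (two-elements 2≤v)) {θ}

    θ≈q₁⇒eigenvalue : ∀ {θ} → θ ≈ fromℚ q₁ → Eigenvalue M θ
    θ≈q₁⇒eigenvalue {θ} θ≈q₁ = θ₁-eigenvalue 1≉0 (proj₂ (proj₂ (two-elements 2≤v)))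
      {θ} (≈-trans {θ} {fromℚ q₁} {θ₁} θ≈q₁ q₁≈θ₁)

    θ≈q₂⇒eigenvalue : ∀ {θ} → θ ≈ fromℚ q₂ → Eigenvalue M θ
    θ≈q₂⇒eigenvalue {θ} θ≈q₂ = θ₂-eigenvalue 1≉0 (proj₁ (two-elements 2≤v)) (proj₂ (proj₂ (two-elements 2≤lam)))
      {θ} (≈-trans {θ} {fromℚ q₂} {θ₂} θ≈q₂ q₂≈θ₂)

  module _ {r₁ r₂ : ℝ} (r₁≈q₁ : r₁ ≈ fromℚ q₁) (r₂≈q₂ : r₂ ≈ fromℚ q₂) where

    0≉r₁ : fromℚ 0ℚ ≉ r₁
    0≉r₁ 0≈r₁ = 0≢q₁ (fromℚ-injective {0ℚ} {q₁} (≈-trans {fromℚ 0ℚ} {r₁} {fromℚ q₁} 0≈r₁ r₁≈q₁))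

    0≉r₂ : fromℚ 0ℚ ≉ r₂
    0≉r₂ 0≈r₂ = 0≢q₂ (fromℚ-injective {0ℚ} {q₂} (≈-trans {fromℚ 0ℚ} {r₂} {fromℚ q₂} 0≈r₂ r₂≈q₂))

    r₁≉r₂ : r₁ ≉ r₂
    r₁≉r₂ r₁≈r₂ = q₁≢q₂ (fromℚ-injective {q₁} {q₂} (≈-trans {fromℚ q₁} {r₁} {fromℚ q₂}
      (≈-sym {r₁} {fromℚ q₁} r₁≈q₁) (≈-trans {r₁} {r₂} {fromℚ q₂} r₁≈r₂ r₂≈q₂)))

    -- Stated for any reals equal to q₁ and q₂, since the sum of reals 1 + 1/(k + λ - 1) in the
    -- theorem agrees with `fromℚ q₂` only up to `_≈_`.
    spectrum : Graph.DistinctℒEigenvalues (RepeatedLines.Γ Π lam) (fromℚ 0ℚ ∷ r₁ ∷ r₂ ∷ [])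
    spectrum = distinctℒEigenvalues (RepeatedLines.Γ Π lam) (fromℚ 0ℚ ∷ r₁ ∷ r₂ ∷ [])
      ((0≉r₁ ∷ 0≉r₂ ∷ []) ∷ (r₁≉r₂ ∷ []) ∷ [] ∷ []) λ W M W≡ M≡ θ → mk⇔
        (λ e → member {θ} (θ∈0,q₁,q₂ W M W≡ M≡ {θ} (IsEigenvalue⇒Eigenvalue (RepeatedLines.Γ Π lam) M θ e)))
        λ where
          (here θ≈0)                 → Eigenvalue⇒IsEigenvalue (RepeatedLines.Γ Π lam) M θ
            (θ≈0⇒eigenvalue W M W≡ M≡ {θ} θ≈0)
          (there (here θ≈r₁))         → Eigenvalue⇒IsEigenvalue (RepeatedLines.Γ Π lam) M θ
            (θ≈q₁⇒eigenvalue W M W≡ M≡ {θ} (≈-trans {θ} {r₁} {fromℚ q₁} θ≈r₁ r₁≈q₁))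
          (there (there (here θ≈r₂))) → Eigenvalue⇒IsEigenvalue (RepeatedLines.Γ Π lam) M θ
            (θ≈q₂⇒eigenvalue W M W≡ M≡ {θ} (≈-trans {θ} {r₂} {fromℚ q₂} θ≈r₂ r₂≈q₂))
      where
      member : ∀ {θ} → θ ≈ fromℚ 0ℚ ⊎ θ ≈ fromℚ q₁ ⊎ θ ≈ fromℚ q₂ → θ ∈ (fromℚ 0ℚ ∷ r₁ ∷ r₂ ∷ [])
      member     (inj₁ θ≈0)         = here θ≈0
      member {θ} (inj₂ (inj₁ θ≈q₁)) = there (here (≈-trans {θ} {fromℚ q₁} {r₁} θ≈q₁ (≈-sym {r₁} {fromℚ q₁} r₁≈q₁)))
      member {θ} (inj₂ (inj₂ θ≈q₂)) = there (there (here (≈-trans {θ} {fromℚ q₂} {r₂} θ≈q₂ (≈-sym {r₂} {fromℚ q₂} r₂≈q₂))))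

mainTheorem6 : ∀ {k v : ℕ} (Π : ProjectivePlane k v) (lam : ℕ) → 2 ≤ lam →
    Graph.DistinctℒEigenvalues (RepeatedLines.Γ Π lam)
    ( fromℚ 0ℚ
    ∷ fromℚ (v ÷ₙ (k * k + k * (lam ∸ 1)))
    ∷ (fromℚ 1ℚ +ᴿ fromℚ (1 ÷ₙ (k + lam ∸ 1)))
    ∷ [] )
mainTheorem6 {k} {v} Π lam 2≤lam = spectrum {r₁} {r₂}
  (≈-pointwise {r₁} {fromℚ q₁} λ _ → ≡.refl)
  (≈-pointwise {r₂} {fromℚ q₂} λ _ → ≡.refl)
  where
  open RepeatedPlane Π lam 2≤lam using (spectrum; q₁; q₂)
  r₁ r₂ : ℝ
  r₁ = fromℚ (v ÷ₙ (k * k + k * (lam ∸ 1)))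
  r₂ = fromℚ 1ℚ +ᴿ fromℚ (1 ÷ₙ (k + lam ∸ 1))
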